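{- Let $g \geq 0$ be a constant integer, and let $m=m(n)$ be an integer-valued function satisfying $0 < \liminf \frac{m}{n} \leq \limsup \frac{m}{n} < 1$. Then there are constants $0<c\le C$ such that with probability tending to $1$ as $n\to\infty$, $cn\le F(S_{g}(n,m)) \le Cn$.
   Context: A graph has genus at most $g$ if it can be embedded without crossing edges on an orientable surface of genus $g$. $\mathcal{S}^{g}(n,m)$ is the set of labelled simple graphs on $[n]$ with exactly $m$ edges and genus at most $g$; $S_{g}(n,m)$ is chosen uniformly at random from it. For a given embedding, the size of a face is the number of edges having a side in the face, counting an edge twice if both sides lie in the face. $F(G)$ is the largest face size of $G$, maximised over all embeddings of $G$ on orientable surfaces of genus at most $g$. -}

module Defs where

open import Data.Nat using (ℕ; zero; suc; _+_; _*_; _≤_; _<ᵇ_)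
open import Data.Bool using (Bool; true; false; _∧_; if_then_else_)
open import Data.Fin using (Fin; toℕ; _≟_)
open import Data.List using (List; map; allFin; length)
open import Data.Nat.ListAction using (sum)
open import Data.List.Relation.Unary.All using (All)
open import Data.List.Relation.Unary.Any using (Any)
open import Data.List.Relation.Unary.AllPairs using (AllPairs)
open import Data.Product using (Σ; ∃; ∃-syntax; _×_; _,_)
open import Data.Sum using (_⊎_; inj₁; inj₂)
open import Relation.Nullary using (¬_)
open import Relation.Nullary.Decidable using (isYes)
open import Relation.Binary.PropositionalEquality using (_≡_; _≢_)
open import Relation.Binary.Construct.Closure.ReflexiveTransitive using (Star)
open import Data.Integer using (+_)
import Data.Rational as ℚ
open ℚ using (ℚ)

RawGraph : ℕ → Set
RawGraph n = Fin n → Fin n → Bool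

IsSimple : ∀ {n} → RawGraph n → Set
IsSimple {n} G = (∀ u v → G u v ≡ G v u) × (∀ v → G v v ≡ false)

edgeCount : ∀ {n} → RawGraph n → ℕ
edgeCount {n} G =
  sum (map (λ u → sum (map (λ v → if (toℕ u <ᵇ toℕ v) ∧ G u v then 1 else 0)
                           (allFin n)))
           (allFin n))

Isolated : ∀ {n} → RawGraph n → Fin n → Set
Isolated {n} G v = ∀ u → G v u ≡ false

iter : ∀ {A : Set} → (A → A) → ℕ → A → A
iter f zero x = x
iter f (suc k) x = f (iter f k x)

-- adjacency in the vertex/face incidence structure, for a given
-- relation "vertex v lies on the boundary of face j"
data Link {n f : ℕ} (G : RawGraph n) (T : Fin n → Fin f → Set)
          : Fin n ⊎ Fin f → Fin n ⊎ Fin f → Set where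
  edge : ∀ u v → G u v ≡ true → Link G T (inj₁ u) (inj₁ v)
  vf   : ∀ v j → T v j → Link G T (inj₁ v) (inj₂ j)
  fv   : ∀ v j → T v j → Link G T (inj₂ j) (inj₁ v)

-- Embeddings of G in a closed orientable surface of genus ≤ g,
-- described combinatorially (not necessarily cellular, G possibly
-- disconnected):
--  * a rotation system  rot v  (cyclic order of the neighbours of v);
--  * boundary walks: the orbits of the face-tracing map on darts
--      (u , v) ↦ (v , rot v u),
--    plus one (empty) boundary walk for each isolated vertex;
--    they are labelled by Fin b;
--  * faces: a surjection from boundary walks to faces Fin f
--    (face j is a sphere with holes glued along its boundary walks);
--  * the resulting surface is connected;
--  * its genus h, given by Euler's formula
--      2 - 2h = n - m + 2f - b,
--    is at most g, i.e.  2 + m + b ≤ 2g + n + 2f.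

record Embedding (g : ℕ) {n : ℕ} (G : RawGraph n) : Set where
  field
    rot      : Fin n → Fin n → Fin n
    rot-nbr  : ∀ v u → G v u ≡ true → G v (rot v u) ≡ true
    rot-cyc  : ∀ v u w → G v u ≡ true → G v w ≡ true →
               ∃[ k ] iter (rot v) k u ≡ w
    b        : ℕ
    walk     : Fin n → Fin n → Fin b     -- label of the walk through dart (u,v)
    iso      : Fin n → Fin b             -- label of the walk of an isolated vertex
    walk-step : ∀ u v → G u v ≡ true → walk v (rot v u) ≡ walk u v
    walk-orbit : ∀ u v u' v' → G u v ≡ true → G u' v' ≡ true →
                 walk u v ≡ walk u' v' →
                 ∃[ k ] iter (λ { (x , y) → (y , rot y x) }) k (u , v) ≡ (u' , v')
    iso-inj  : ∀ v v' → Isolated G v → Isolated G v' → iso v ≡ iso v' → v ≡ v'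
    iso-new  : ∀ v u w → Isolated G v → G u w ≡ true → iso v ≢ walk u w
    walk-sur : ∀ (t : Fin b) →
               (∃[ u ] ∃[ v ] (G u v ≡ true × walk u v ≡ t)) ⊎
               (∃[ v ] (Isolated G v × iso v ≡ t))
    f        : ℕ
    face     : Fin b → Fin f
    face-sur : ∀ (j : Fin f) → ∃[ t ] face t ≡ j
    -- the surface is connected: the graph on vertices and faces, with the
    -- edges of G and vertex–face incidences, is connected
    connected : ∀ x y →
      Star (Link G (λ v j → (Isolated G v × face (iso v) ≡ j) ⊎
                            (∃[ w ] (G v w ≡ true × face (walk v w) ≡ j)))) x y
    genus-ok  : 2 + edgeCount G + b ≤ 2 * g + n + 2 * f

  faceSize : Fin f → ℕ
  faceSize j =
    sum (map (λ u → sum (map (λ v → if G u v ∧ isYes (face (walk u v) ≟ j) then 1 else 0)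
                             (allFin n)))
             (allFin n))

open Embedding public

GenusAtMost : ℕ → ∀ {n} → RawGraph n → Set
GenusAtMost g G = Embedding g G

InS : ℕ → (n m : ℕ) → RawGraph n → Set
InS g n m G = IsSimple G × edgeCount G ≡ m × GenusAtMost g G

toℚ : ℕ → ℚ
toℚ k = (+ k) ℚ./ 1

-- "c n ≤ F(G) ≤ C n", where F(G) = max over embeddings (genus ≤ g)
-- and faces of the face size
FaceBounds : ℕ → ℚ → ℚ → ∀ {n} → RawGraph n → Set
FaceBounds g c C {n} G =
  (Σ (Embedding g G) λ E → ∃[ j ] (c ℚ.* toℚ n) ℚ.≤ toℚ (faceSize E j)) ×
  (∀ (E : Embedding g G) j → toℚ (faceSize E j) ℚ.≤ (C ℚ.* toℚ n))

_≗G_ : ∀ {n} → RawGraph n → RawGraph n → Set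
G ≗G H = ∀ u v → G u v ≡ H u v

Distinct : ∀ {n} → List (RawGraph n) → Set
Distinct = AllPairs (λ G H → ∃[ u ] ∃[ v ] G u v ≢ H u v)

_∈G_ : ∀ {n} → RawGraph n → List (RawGraph n) → Set
G ∈G L = Any (λ H → G ≗G H) L

-- P(S_g(n,m) fails P) ≤ ε :  |{G ∈ 𝒮^g(n,m) : ¬ P G}| ≤ ε |𝒮^g(n,m)|,
-- witnessed by a distinct list K ⊆ 𝒮^g(n,m) and a list L covering
-- all bad graphs with |L| ≤ ε |K|.
FailProbAtMost : ℕ → (n m : ℕ) → (RawGraph n → Set) → ℚ → Set
FailProbAtMost g n m P ε =
  Σ (List (RawGraph n)) λ K → Σ (List (RawGraph n)) λ L →
    Distinct K × All (InS g n m) K ×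
    (∀ G → InS g n m G → ¬ P G → G ∈G L) ×
    toℚ (length L) ℚ.≤ (ε ℚ.* toℚ (length K))

{-# OPTIONS --safe #-}
module Submission where

-- Gluing along one boundary walk per component puts all components of a graph into one common face
-- without raising the genus, so F is at least the number of components that have an edge.  There are
-- at least n - m components, hence either F is linear in n, or linearly many vertices are isolated
-- and only few components are single edges.  In the second case a switch (delete any edge, then
-- join two isolated vertices) preserves the genus bound and the number of edges.  It can be done in
-- order n³ ways and undone in at most n² ways per single-edge component, so raising the threshold on
-- the number of single-edge components by a constant at least doubles the number of such graphs.
-- After t rounds the graphs of the second kind are seen to be at most a 2⁻ᵗ fraction.
-- Whether a graph embeds is a finite search, which makes these counts meaningful constructively.

open import Defs
open import Data.Nat using (ℕ; _≥_)
open import Data.Product using (Σ; ∃; ∃-syntax; _×_)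

-- No lower bound holds for every single graph: for `g = 0`, a triangulation together with isolated
-- vertices has only faces of size three, because an isolated vertex adds nothing to a face size.
-- Such graphs have to be outnumbered. The trace that a switch leaves is a single-edge component, so
-- a graph with few of these offers few places where a switch can be undone. The obstacle is that
-- faces need not be discs and that deleting an edge may disconnect the graph. Both are handled by
-- `Weak`, Euler's inequality summed over the components, which mentions boundary walks but no
-- faces. For a simple graph with a vertex it is equivalent to embeddability, and its behaviour
-- under deletion and addition of an edge is a matter of counting labels. Constants: for large n
-- some `q` satisfies n/q ≤ m ≤ (1 - 1/q) n. Then c = 1/(s + 1) with s = 8 (8q)³, and C = 2, since m
-- ≤ n edges have at most 2n sides.

module Combinatorics where

  open import Data.Bool using (Bool; true; false; _∧_; if_then_else_; not)
  import Data.Bool.Properties as Bool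
  open import Data.Empty using (⊥; ⊥-elim)
  open import Data.Fin using (Fin; zero; suc; toℕ; _≟_; punchIn; punchOut; combine; remQuot; fromℕ<; finToFun; funToFin; splitAt; _↑ˡ_; _↑ʳ_)
  open import Data.Fin.Properties using (suc-injective; toℕ-injective; toℕ<n; toℕ-fromℕ<; punchInᵢ≢i; punchOut-punchIn; punchOut-injective; punchOut-cong; pigeonhole; injective⇒≤; combine-injective; remQuot-combine; splitAt⁻¹-↑ˡ; splitAt⁻¹-↑ʳ; finToFun-funToFin; funToFin-finToFin; any?; all?)
  open import Data.List using (List; []; _∷_; [_]; map; allFin; length; tabulate; concatMap; filter)
  open import Data.List.Properties using (map-tabulate; map-cong; length-++; length-map; length-tabulate)
  open import Data.List.Membership.Propositional using (lose)
  open import Data.List.Membership.Propositional.Properties using (∈-allFin; ∈-filter⁺)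
  open import Data.List.Relation.Unary.All using (All; []; _∷_)
  import Data.List.Relation.Unary.All as All
  import Data.List.Relation.Unary.All.Properties as All
  import Data.List.Relation.Unary.AllPairs as AllPairs
  import Data.List.Relation.Unary.AllPairs.Properties as AllPairs
  import Data.List.Relation.Unary.Any.Properties as Any
  open import Data.List.Relation.Unary.Unique.Propositional.Properties using (allFin⁺)
  open import Data.Nat using (zero; suc; _+_; _*_; _∸_; _^_; _≤_; _<_; _<ᵇ_; _≤?_; _<?_; z≤n; s≤s; NonZero; >-nonZero)
  import Data.Nat as ℕ
  open import Data.Nat.DivMod using (_/_; _%_; m≡m%n+[m/n]*n; m%n<n)
  open import Data.Nat.Induction using (<-wellFounded)
  open import Data.Nat.ListAction using (sum)
  open import Data.Nat.Properties hiding (_≟_; _≤?_; _<?_; suc-injective)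
  open import Data.Nat.Tactic.RingSolver using (solve-∀)
  open import Data.Product using (_,_; proj₁; proj₂)
  open import Data.Sum using (_⊎_; inj₁; inj₂)
  open import Data.Unit using (⊤; tt)
  open import Function using (_∘_; id)
  open import Induction.WellFounded using (Acc; acc)
  open import Relation.Binary using (tri<; tri≈; tri>)
  open import Relation.Binary.Construct.Closure.ReflexiveTransitive using (Star; ε; _◅_; _◅◅_; reverse; gmap)
  open import Relation.Binary.PropositionalEquality hiding ([_]; J; resp)
  open import Relation.Nullary using (¬_; Dec; yes; no)
  open import Relation.Nullary.Decidable using (isYes; map′; _×-dec_; _⊎-dec_; _→-dec_; ¬?; decidable-stable)

  -- Sums over Fin n

  ∑ : ∀ {n} → (Fin n → ℕ) → ℕ
  ∑ {n} f = sum (map f (allFin n))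

  ⟦_⟧ : Bool → ℕ
  ⟦ b ⟧ = if b then 1 else 0

  ⟦⟧≤1 : ∀ b → ⟦ b ⟧ ≤ 1
  ⟦⟧≤1 true = ≤-refl
  ⟦⟧≤1 false = z≤n

  ⟦⟧-mono : ∀ {b c} → (b ≡ true → c ≡ true) → ⟦ b ⟧ ≤ ⟦ c ⟧
  ⟦⟧-mono {false} h = z≤n
  ⟦⟧-mono {true} {c} h rewrite h refl = ≤-refl

  ∑-suc : ∀ {n} (f : Fin (suc n) → ℕ) → ∑ f ≡ f zero + ∑ (f ∘ suc)
  ∑-suc {n} f = cong (λ l → f zero + sum l) (begin
    map f (tabulate suc)      ≡⟨ map-tabulate suc f ⟩
    tabulate (f ∘ suc)        ≡⟨ map-tabulate id (f ∘ suc) ⟨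
    map (f ∘ suc) (allFin n)  ∎)
    where open ≡-Reasoning

  ∑-mono : ∀ {n} {f g : Fin n → ℕ} → (∀ i → f i ≤ g i) → ∑ f ≤ ∑ g
  ∑-mono {zero} h = z≤n
  ∑-mono {suc n} {f} {g} h rewrite ∑-suc f | ∑-suc g = +-mono-≤ (h zero) (∑-mono (h ∘ suc))

  ∑-cong : ∀ {n} {f g : Fin n → ℕ} → (∀ i → f i ≡ g i) → ∑ f ≡ ∑ g
  ∑-cong h = ≤-antisym (∑-mono (≤-reflexive ∘ h)) (∑-mono (≤-reflexive ∘ sym ∘ h))

  ∑-+ : ∀ {n} (f g : Fin n → ℕ) → ∑ (λ i → f i + g i) ≡ ∑ f + ∑ g
  ∑-+ {zero} f g = refl
  ∑-+ {suc n} f g rewrite ∑-suc f | ∑-suc g | ∑-suc (λ i → f i + g i) | ∑-+ (f ∘ suc) (g ∘ suc) =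
    interchange (f zero) (g zero) (∑ (f ∘ suc)) (∑ (g ∘ suc))
    where
    interchange : ∀ a b c d → (a + b) + (c + d) ≡ (a + c) + (b + d)
    interchange = solve-∀

  ∑-const : ∀ n c → ∑ {n} (λ _ → c) ≡ n * c
  ∑-const zero c = refl
  ∑-const (suc n) c rewrite ∑-suc {n} (λ _ → c) | ∑-const n c = refl

  ∑-*ʳ : ∀ {n} (f : Fin n → ℕ) c → ∑ (λ i → f i * c) ≡ ∑ f * c
  ∑-*ʳ {zero} f c = refl
  ∑-*ʳ {suc n} f c rewrite ∑-suc f | ∑-suc (λ i → f i * c) | ∑-*ʳ (f ∘ suc) c =
    sym (*-distribʳ-+ c (f zero) (∑ (f ∘ suc)))

  ∑-*ˡ : ∀ {n} c (f : Fin n → ℕ) → ∑ (λ i → c * f i) ≡ c * ∑ f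
  ∑-*ˡ c f = trans (∑-cong (λ i → *-comm c (f i))) (trans (∑-*ʳ f c) (*-comm (∑ f) c))

  ∑-swap : ∀ {m n} (f : Fin m → Fin n → ℕ) → ∑ (λ i → ∑ (f i)) ≡ ∑ (λ j → ∑ (λ i → f i j))
  ∑-swap {zero} {n} f = sym (trans (∑-const n 0) (*-zeroʳ n))
  ∑-swap {suc m} {n} f = begin
    ∑ (λ i → ∑ (f i))                              ≡⟨ ∑-suc (λ i → ∑ (f i)) ⟩
    ∑ (f zero) + ∑ (λ i → ∑ (f (suc i)))           ≡⟨ cong (∑ (f zero) +_) (∑-swap (f ∘ suc)) ⟩
    ∑ (f zero) + ∑ (λ j → ∑ (λ i → f (suc i) j))   ≡⟨ ∑-+ (f zero) _ ⟨
    ∑ (λ j → f zero j + ∑ (λ i → f (suc i) j))     ≡⟨ ∑-cong (λ j → ∑-suc (λ i → f i j)) ⟨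
    ∑ (λ j → ∑ (λ i → f i j))                      ∎
    where open ≡-Reasoning

  term≤∑ : ∀ {n} (f : Fin n → ℕ) i → f i ≤ ∑ f
  term≤∑ f zero rewrite ∑-suc f = m≤m+n _ _
  term≤∑ f (suc i) rewrite ∑-suc f = ≤-trans (term≤∑ (f ∘ suc) i) (m≤n+m _ _)

  ∑-unique : ∀ {n} (b : Fin n → Bool) → (∀ i j → b i ≡ true → b j ≡ true → i ≡ j) →
    ∑ (λ i → ⟦ b i ⟧) ≤ 1
  ∑-unique {zero} b h = z≤n
  ∑-unique {suc n} b h rewrite ∑-suc (λ i → ⟦ b i ⟧) with b zero in eq
  ... | false = ∑-unique (b ∘ suc) (λ i j p q → suc-injective (h (suc i) (suc j) p q))
  ... | true = ≤-reflexive (cong suc (trans (∑-cong zeros) (trans (∑-const n 0) (*-zeroʳ n))))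
    where
    zeros : ∀ i → ⟦ b (suc i) ⟧ ≡ 0
    zeros i with b (suc i) in eq′
    ... | false = refl
    ... | true with () ← h zero (suc i) eq eq′

  isYes-true : ∀ {A : Set} (d : Dec A) → isYes d ≡ true → A
  isYes-true (yes a) _ = a

  true-isYes : ∀ {A : Set} (d : Dec A) → A → isYes d ≡ true
  true-isYes (yes _) _ = refl
  true-isYes (no ¬a) a = ⊥-elim (¬a a)

  -- Double counting of the 0-1 matrix of `ι i ≡ j`: each row contains its own entry, and
  -- injectivity leaves at most one entry in each column.
  ∑-injective : ∀ {m n} (ι : Fin m → Fin n) → (∀ i j → ι i ≡ ι j → i ≡ j) →
    (f : Fin n → ℕ) → ∑ (f ∘ ι) ≤ ∑ f
  ∑-injective {m} {n} ι inj f = begin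
    ∑ (λ i → f (ι i))                              ≤⟨ ∑-mono (λ i → ≤-trans (at i) (term≤∑ (λ j → δ i j * f j) (ι i))) ⟩
    ∑ (λ i → ∑ (λ j → δ i j * f j))                ≡⟨ ∑-swap {m} {n} (λ i j → δ i j * f j) ⟩
    ∑ (λ j → ∑ (λ i → δ i j * f j))                ≡⟨ ∑-cong (λ j → ∑-*ʳ (λ i → δ i j) (f j)) ⟩
    ∑ (λ j → ∑ (λ i → δ i j) * f j)                ≤⟨ ∑-mono (λ j → *-monoˡ-≤ (f j) (∑-unique (λ i → isYes (ι i ≟ j)) (uniq j))) ⟩
    ∑ (λ j → 1 * f j)                              ≡⟨ ∑-cong (λ j → *-identityˡ (f j)) ⟩
    ∑ f                                            ∎
    where
    open ≤-Reasoning
    δ : _ → _ → ℕ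
    δ i j = ⟦ isYes (ι i ≟ j) ⟧
    at : ∀ i → f (ι i) ≤ δ i (ι i) * f (ι i)
    at i rewrite true-isYes (ι i ≟ ι i) refl = ≤-reflexive (sym (*-identityˡ _))
    uniq : ∀ j i i′ → isYes (ι i ≟ j) ≡ true → isYes (ι i′ ≟ j) ≡ true → i ≡ i′
    uniq j i i′ p q = inj i i′ (trans (isYes-true (ι i ≟ j) p) (sym (isYes-true (ι i′ ≟ j) q)))

  -- Iteration

  module _ {A : Set} (f : A → A) where

    iter-+ : ∀ j k x → iter f (j + k) x ≡ iter f j (iter f k x)
    iter-+ zero k x = refl
    iter-+ (suc j) k x = cong f (iter-+ j k x)

    iter-sucˡ : ∀ k x → iter f (suc k) x ≡ iter f k (f x)
    iter-sucˡ zero x = refl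
    iter-sucˡ (suc k) x = cong f (iter-sucˡ k x)

    Reach : A → A → Set
    Reach x y = ∃[ k ] iter f k x ≡ y

    reach-trans : ∀ {x y z} → Reach x y → Reach y z → Reach x z
    reach-trans {x} (j , refl) (k , refl) = k + j , iter-+ k j x

    -- The k-th and the l-th iterate of c are both its (k + l + k l)-th iterate.
    cyclic-injective : ∀ {c} k l → iter f (suc k) c ≡ c → iter f (suc l) c ≡ c →
      iter f k c ≡ iter f l c
    cyclic-injective {c} k l p q = begin
      iter f k c                          ≡⟨ cong (iter f k) (loops (suc k) l p) ⟨
      iter f k (iter f (l * suc k) c)     ≡⟨ iter-+ k (l * suc k) c ⟨
      iter f (k + l * suc k) c            ≡⟨ cong (λ j → iter f j c) (exponent k l) ⟩
      iter f (l + k * suc l) c            ≡⟨ iter-+ l (k * suc l) c ⟩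
      iter f l (iter f (k * suc l) c)     ≡⟨ cong (iter f l) (loops (suc l) k q) ⟩
      iter f l c                          ∎
      where
      open ≡-Reasoning
      loops : ∀ a b → iter f a c ≡ c → iter f (b * a) c ≡ c
      loops a zero h = refl
      loops a (suc b) h = trans (iter-+ a (b * a) c) (trans (cong (iter f a) (loops a b h)) h)
      exponent : ∀ k l → k + l * suc k ≡ l + k * suc l
      exponent = solve-∀

    module _ (D : A → Set) (closed : ∀ {x} → D x → D (f x)) where

      iter-closed : ∀ k {x} → D x → D (iter f k x)
      iter-closed zero d = d
      iter-closed (suc k) d = closed (iter-closed k d)

      module _ (inj : ∀ {x y} → D x → D y → f x ≡ f y → x ≡ y)
               {N} (code : A → Fin N) (code-inj : ∀ {x y} → code x ≡ code y → x ≡ y) where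

        -- Two of the first N + 1 iterates collide, and injectivity strips their common prefix until
        -- `x` itself is hit. This makes `Reach` symmetric on `D`, so that orbits are the classes of
        -- an equivalence relation.
        reach-back : ∀ {x} → D x → Reach (f x) x
        reach-back {x} d with pigeonhole (n<1+n N) (λ i → code (iter f (toℕ i) x))
        ... | i , j , i<j , eq = back (toℕ i) (toℕ j) i<j (code-inj eq)
          where
          back : ∀ a b → a < b → iter f a x ≡ iter f b x → Reach (f x) x
          back zero (suc b) _ e = b , trans (sym (iter-sucˡ b x)) (sym e)
          back (suc a) (suc b) (s≤s a<b) e =
            back a b a<b (inj (iter-closed a d) (iter-closed b d) e)

        reach-sym : ∀ {x y} → D x → Reach x y → Reach y x
        reach-sym d (zero , refl) = zero , refl
        reach-sym d (suc k , refl) =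
          reach-trans (reach-back (iter-closed k d)) (reach-sym d (k , refl))

  iter-cong : ∀ {A : Set} {f g : A → A} → (∀ x → f x ≡ g x) → ∀ k x → iter f k x ≡ iter g k x
  iter-cong h zero x = refl
  iter-cong {f = f} h (suc k) x = trans (cong f (iter-cong h k x)) (h _)

  -- At most n steps suffice: in a longer path two of the first n + 1 iterates coincide, and the
  -- loop between them can be cut out.
  reach? : ∀ {n} (f : Fin n → Fin n) x y → Dec (Reach f x y)
  reach? {n} f x y = map′
    (λ (k , e) → toℕ k , e)
    (λ (k , e) → shorten k (<-wellFounded k) e)
    (any? {n = suc n} (λ k → iter f (toℕ k) x ≟ y))
    where
    shorten : ∀ k → Acc _<_ k → iter f k x ≡ y → ∃[ i ] iter f (toℕ {suc n} i) x ≡ y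
    shorten k (acc rec) e with k <? suc n
    ... | yes k≤n = fromℕ< k≤n , trans (cong (λ j → iter f j x) (toℕ-fromℕ< k≤n)) e
    ... | no k≰n with pigeonhole (n<1+n n) (λ i → iter f (toℕ i) x)
    ... | i , j , i<j , eq = shorten (k ∸ toℕ j + toℕ i) (rec smaller) (begin
        iter f (k ∸ toℕ j + toℕ i) x         ≡⟨ iter-+ f (k ∸ toℕ j) (toℕ i) x ⟩
        iter f (k ∸ toℕ j) (iter f (toℕ i) x) ≡⟨ cong (iter f (k ∸ toℕ j)) eq ⟩
        iter f (k ∸ toℕ j) (iter f (toℕ j) x) ≡⟨ iter-+ f (k ∸ toℕ j) (toℕ j) x ⟨
        iter f (k ∸ toℕ j + toℕ j) x         ≡⟨ cong (λ l → iter f l x) k-eq ⟩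
        iter f k x                           ≡⟨ e ⟩
        y                                    ∎)
      where
      open ≡-Reasoning
      k-eq : k ∸ toℕ j + toℕ j ≡ k
      k-eq = m∸n+n≡m (≤-trans (<⇒≤ (toℕ<n j)) (≮⇒≥ k≰n))
      smaller : k ∸ toℕ j + toℕ i < k
      smaller = subst (k ∸ toℕ j + toℕ i <_) k-eq (+-monoʳ-< (k ∸ toℕ j) i<j)

  -- Quotients of Fin N

  Onto : ∀ {m n} → (Fin m → Fin n) → Set
  Onto f = ∀ j → ∃[ i ] f i ≡ j

  merge : ∀ {k} (u v : Fin (suc k)) → u ≢ v → Σ (Fin (suc k) → Fin k) λ μ →
    μ u ≡ μ v × Onto μ ×
    (∀ s t → μ s ≡ μ t → s ≡ t ⊎ (s ≡ u × t ≡ v) ⊎ (s ≡ v × t ≡ u))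
  merge {k} u v u≢v = μ , together , onto , reflect
    where
    μ : Fin (suc k) → Fin k
    μ s with v ≟ s
    ... | yes _ = punchOut (u≢v ∘ sym)
    ... | no v≢s = punchOut v≢s
    together : μ u ≡ μ v
    together with v ≟ u | v ≟ v
    ... | yes v≡u | _ = ⊥-elim (u≢v (sym v≡u))
    ... | no _ | yes _ = punchOut-cong v refl
    ... | no _ | no v≢v = ⊥-elim (v≢v refl)
    onto : Onto μ
    onto j = punchIn v j , lemma
      where
      lemma : μ (punchIn v j) ≡ j
      lemma with v ≟ punchIn v j
      ... | yes e = ⊥-elim (punchInᵢ≢i v j (sym e))
      ... | no _ = trans (punchOut-cong v refl) (punchOut-punchIn v)
    reflect : ∀ s t → μ s ≡ μ t → s ≡ t ⊎ (s ≡ u × t ≡ v) ⊎ (s ≡ v × t ≡ u)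
    reflect s t e with v ≟ s | v ≟ t
    ... | yes refl | yes refl = inj₁ refl
    ... | yes refl | no p = inj₂ (inj₂ (refl , sym (punchOut-injective (u≢v ∘ sym) p e)))
    ... | no p | yes refl = inj₂ (inj₁ (punchOut-injective p (u≢v ∘ sym) e , refl))
    ... | no p | no q = inj₁ (punchOut-injective p q e)

  record IsEquiv {A : Set} (R : A → A → Set) : Set where
    field
      re : ∀ {x} → R x x
      sy : ∀ {x y} → R x y → R y x
      tr : ∀ {x y z} → R x y → R y z → R x z

  open IsEquiv

  -- Every listed pair costs at most one class, whence the size bound. With a genuine `R` the
  -- classes become orbits or components; with the trivial relation only the count matters, as in
  -- the Euler-type inequalities for glued faces.
  union-find : ∀ {N} {R : Fin N → Fin N → Set} → IsEquiv R → (es : List (Fin N × Fin N)) →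
    All (λ (u , v) → R u v) es →
    ∃[ κ ] Σ (Fin N → Fin κ) λ c → Onto c × All (λ (u , v) → c u ≡ c v) es ×
      (∀ u v → c u ≡ c v → R u v) × N ≤ κ + length es
  union-find {N} eq [] [] =
    N , id , (λ j → j , refl) , [] , (λ { u .u refl → re eq }) , ≤-reflexive (sym (+-identityʳ N))
  union-find {N} {R} eq ((u , v) ∷ es) (r ∷ rs) with union-find eq es rs
  ... | zero , c , _ = ⊥-elim (none (c u)) where
    none : Fin 0 → ⊥
    none ()
  ... | suc κ , c , onto , resp , sound , size with c u ≟ c v
  ...   | yes e = suc κ , c , onto , e ∷ resp , sound ,
                  ≤-trans size (+-monoʳ-≤ (suc κ) (n≤1+n (length es)))
  ...   | no ne with merge (c u) (c v) ne
  ...     | μ , together , μ-onto , reflect =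
    κ , μ ∘ c , onto′ , together ∷ All.map (cong μ) resp , sound′ ,
    ≤-trans size (≤-reflexive (sym (+-suc κ (length es))))
    where
    onto′ : Onto (μ ∘ c)
    onto′ j with μ-onto j
    ... | i , refl with onto i
    ... | x , refl = x , refl
    sound′ : ∀ x y → μ (c x) ≡ μ (c y) → R x y
    sound′ x y e with reflect (c x) (c y) e
    ... | inj₁ p = sound x y p
    ... | inj₂ (inj₁ (p , q)) = tr eq (sound x u p) (tr eq r (sound v y (sym q)))
    ... | inj₂ (inj₂ (p , q)) = tr eq (sound x v p) (tr eq (sy eq r) (sound u y (sym q)))

  -- Rotation systems and boundary walks

  Edge : ∀ {n} → RawGraph n → Fin n → Fin n → Set
  Edge G u v = G u v ≡ true

  edge? : ∀ {n} (G : RawGraph n) u v → Dec (Edge G u v)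
  edge? G u v = G u v Bool.≟ true

  isolated? : ∀ {n} (G : RawGraph n) u → Dec (Isolated G u)
  isolated? G u = all? (λ v → G u v Bool.≟ false)

  no-edge : ∀ {n} (G : RawGraph n) {u v} → ¬ Edge G u v → G u v ≡ false
  no-edge G ne = Bool.¬-not ne

  false≢true : false ≢ true
  false≢true ()

  isolated-no-edge : ∀ {n} (G : RawGraph n) {u v} → Isolated G u → ¬ Edge G u v
  isolated-no-edge G i e = false≢true (trans (sym (i _)) e)

  -- An isolated vertex carries a loop dart, so that its empty boundary walk becomes an ordinary
  -- orbit of the face-tracing map.
  Dart : ∀ {n} → RawGraph n → Fin n → Fin n → Set
  Dart G u v = Edge G u v ⊎ (u ≡ v × Isolated G u)

  dart? : ∀ {n} (G : RawGraph n) u v → Dec (Dart G u v)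
  dart? G u v = edge? G u v ⊎-dec ((u ≟ v) ×-dec isolated? G u)

  a-dart : ∀ {n} (G : RawGraph n) u → ∃[ v ] Dart G u v
  a-dart G u with any? (edge? G u)
  ... | yes (v , e) = v , inj₁ e
  ... | no none = u , inj₂ (refl , λ v → no-edge G (λ e → none (v , e)))

  module _ {n} {G : RawGraph n} (simple : IsSimple G) where

    edge-sym : ∀ {u v} → Edge G u v → Edge G v u
    edge-sym {u} {v} = trans (proj₁ simple v u)

    dart-sym : ∀ {u v} → Dart G u v → Dart G v u
    dart-sym (inj₁ e) = inj₁ (edge-sym e)
    dart-sym (inj₂ (refl , i)) = inj₂ (refl , i)

    edge-≢ : ∀ {u v} → Edge G u v → u ≢ v
    edge-≢ {u} e refl = false≢true (trans (sym (proj₂ simple u)) e)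

  record Rotation {n} (G : RawGraph n) (rot : Fin n → Fin n → Fin n) : Set where
    field
      rot-dart : ∀ {v u} → Dart G v u → Dart G v (rot v u)
      rot-reach : ∀ {v u w} → Dart G v u → Dart G v w → Reach (rot v) u w

  step : ∀ {n} → (Fin n → Fin n → Fin n) → Fin n × Fin n → Fin n × Fin n
  step rot (x , y) = y , rot y x

  record Labelling {n} (G : RawGraph n) (rot : Fin n → Fin n → Fin n) (b : ℕ) : Set where
    field
      label : Fin n → Fin n → Fin b
      label-step : ∀ {x y} → Dart G x y → label y (rot y x) ≡ label x y
      label-onto : ∀ t → ∃[ x ] ∃[ y ] (Dart G x y × label x y ≡ t)

  open Labelling

  Exact : ∀ {n G rot b} → Labelling {n} G rot b → Set
  Exact {G = G} {rot} L = ∀ {x y x′ y′} → Dart G x y → Dart G x′ y′ →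
    label L x y ≡ label L x′ y′ → Reach (step rot) (x , y) (x′ , y′)

  record Components {n} (G : RawGraph n) (κ : ℕ) : Set where
    field
      comp : Fin n → Fin κ
      comp-edge : ∀ {u v} → Edge G u v → comp u ≡ comp v
      comp-path : ∀ {u v} → comp u ≡ comp v → Star (Edge G) u v
      comp-onto : Onto comp

    comp-dart : ∀ {u v} → Dart G u v → comp u ≡ comp v
    comp-dart (inj₁ e) = comp-edge e
    comp-dart (inj₂ (refl , _)) = refl

  open Components

  -- The labels need not separate the orbits of the face-tracing map: a coarser labelling only
  -- makes the inequality harder to satisfy.
  record Weak (g : ℕ) {n : ℕ} (G : RawGraph n) : Set where
    constructor weak
    field
      {rot′} : Fin n → Fin n → Fin n
      {b′ κ′} : ℕ
      rotation : Rotation G rot′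
      labelling : Labelling G rot′ b′
      components : Components G κ′
      -- A component of genus h satisfies n - m + b = 2 - 2h, an isolated vertex being a sphere with
      -- one walk. Summed over the components this says that the genera add up to at most g, when
      -- `b′` is the true number of walks.
      genus : edgeCount G + 2 * κ′ ≤ 2 * g + n + b′

  module RotationProperties {n} {G : RawGraph n} (simple : IsSimple G)
                            {rot : Fin n → Fin n → Fin n} (ρ : Rotation G rot) where
    open Rotation ρ

    -- Transitivity of the iterates forces injectivity: the common image reaches both `a` and `a′`
    -- and is one step after each, so both are its predecessor on one cycle.
    rot-injective : ∀ {v a a′} → Dart G v a → Dart G v a′ → rot v a ≡ rot v a′ → a ≡ a′
    rot-injective {v} {a} {a′} d d′ e
      with rot-reach (rot-dart d) d | rot-reach (rot-dart d) d′
    ... | k , p | l , q = trans (sym p) (trans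
      (cyclic-injective (rot v) k l (cong (rot v) p) (trans (cong (rot v) q) (sym e))) q)

    private
      D : Fin n × Fin n → Set
      D (x , y) = Dart G x y

      code : Fin n × Fin n → Fin (n * n)
      code (x , y) = combine x y

      code-inj : ∀ {d d′} → code d ≡ code d′ → d ≡ d′
      code-inj {x , y} {x′ , y′} e with combine-injective x y x′ y′ e
      ... | refl , refl = refl

      step-closed : ∀ {d} → D d → D (step rot d)
      step-closed d = rot-dart (dart-sym simple d)

      step-injective : ∀ {d d′} → D d → D d′ → step rot d ≡ step rot d′ → d ≡ d′
      step-injective {x , y} {x′ , y′} d d′ e with cong proj₁ e
      ... | refl = cong (_, y) (rot-injective (dart-sym simple d) (dart-sym simple d′) (cong proj₂ e))

      -- The classes are formed on all n² ordered pairs. A pair that is not a dart is counted with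
      -- some dart at its first vertex, so that no class is without darts.
      norm : Fin n × Fin n → Fin n × Fin n
      norm (u , v) with dart? G u v
      ... | yes _ = u , v
      ... | no _ = u , proj₁ (a-dart G u)

      norm-dart : ∀ d → D (norm d)
      norm-dart (u , v) with dart? G u v
      ... | yes d = d
      ... | no _ = proj₂ (a-dart G u)

      norm-id : ∀ {d} → D d → norm d ≡ d
      norm-id {u , v} d with dart? G u v
      ... | yes _ = refl
      ... | no nd = ⊥-elim (nd d)

      dec : Fin (n * n) → Fin n × Fin n
      dec = remQuot {n} n

      dec-code : ∀ d → dec (code d) ≡ d
      dec-code (x , y) = remQuot-combine x y

      R : Fin (n * n) → Fin (n * n) → Set
      R i j = Reach (step rot) (norm (dec i)) (norm (dec j))

      R-equiv : IsEquiv R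
      R-equiv = record
        { re = 0 , refl
        ; sy = λ {i} → reach-sym (step rot) D step-closed step-injective code code-inj
                 (norm-dart (dec i))
        ; tr = reach-trans (step rot)
        }

      next : Fin (n * n) → Fin (n * n)
      next i = code (step rot (norm (dec i)))

      R-next : ∀ i → R i (next i)
      R-next i = 1 , sym (trans (cong norm (dec-code _)) (norm-id (step-closed (norm-dart (dec i)))))

    exact-labelling : ∃[ b ] Σ (Labelling G rot b) Exact
    exact-labelling
      with union-find R-equiv (map (λ i → i , next i) (allFin (n * n)))
             (All.map⁺ (All.universal R-next _))
    ... | b , c , onto , resp , sound , _ = b , L , exact
      where
      c-next : ∀ i → c i ≡ c (next i)
      c-next i = All.lookup (All.map⁻ resp) (∈-allFin i)
      L : Labelling G rot b
      L .label x y = c (combine x y)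
      L .label-step {x} {y} d = sym (trans (c-next (combine x y))
        (cong (c ∘ code ∘ step rot) (trans (cong norm (dec-code (x , y))) (norm-id d))))
      L .label-onto t with onto t
      -- The pair coded by `i` may fail to be a dart; its successor `next i` always is one and lies
      -- in the same class.
      ... | i , refl = _ , _ , step-closed (norm-dart (dec i)) , sym (c-next i)
      exact : Exact L
      exact {x} {y} {x′} {y′} d d′ e = subst₂ (Reach (step rot))
        (trans (cong norm (dec-code (x , y))) (norm-id d))
        (trans (cong norm (dec-code (x′ , y′))) (norm-id d′))
        (sound (combine x y) (combine x′ y′) e)

    label-reach : ∀ {b} (L : Labelling G rot b) {x y x′ y′} → Dart G x y →
      Reach (step rot) (x , y) (x′ , y′) → label L x y ≡ label L x′ y′
    label-reach L d (zero , refl) = refl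
    label-reach L {x} {y} d (suc k , refl) =
      trans (label-reach L d (k , refl))
            (sym (label-step L (iter-closed (step rot) D step-closed k {x , y} d)))

    -- Labels are constant along orbits, so distinct labels have darts in distinct orbits. Hence an
    -- exact labelling may replace any other in the genus inequality.
    exact-finest : ∀ {b b*} (L : Labelling G rot b) (L* : Labelling G rot b*) → Exact L* → b ≤ b*
    exact-finest {b} {b*} L L* exact = injective⇒≤ {f = refine} inj
      where
      refine : Fin b → Fin b*
      refine t = let (x , y , _) = label-onto L t in label L* x y
      inj : ∀ {t t′} → refine t ≡ refine t′ → t ≡ t′
      inj {t} {t′} e with label-onto L t | label-onto L t′
      ... | x , y , d , refl | x′ , y′ , d′ , refl = label-reach L d (exact d d′ e)

  star-respects : ∀ {A B : Set} {T : A → A → Set} (c : A → B) → (∀ {u v} → T u v → c u ≡ c v) →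
    ∀ {u v} → Star T u v → c u ≡ c v
  star-respects c h ε = refl
  star-respects c h (e ◅ es) = trans (h e) (star-respects c h es)

  -- A map that respects edges is constant on components. Applied to other component maps it shows
  -- that the number of components does not depend on their presentation; applied after merging it
  -- bounds the effect of a deletion.
  components-most : ∀ {n} {G : RawGraph n} {κ κ*} (K : Components G κ) (c : Fin n → Fin κ*) →
    Onto c → (∀ {u v} → Edge G u v → c u ≡ c v) → κ* ≤ κ
  components-most K c onto resp = injective⇒≤ {f = λ t → comp K (proj₁ (onto t))}
    λ {t} {t′} e → trans (sym (proj₂ (onto t)))
      (trans (star-respects c resp (comp-path K e)) (proj₂ (onto t′)))

  length-concatMap : ∀ {A B : Set} (f : A → List B) xs →
    length (concatMap f xs) ≡ sum (map (length ∘ f) xs)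
  length-concatMap f [] = refl
  length-concatMap f (x ∷ xs) =
    trans (length-++ (f x)) (cong (length (f x) +_) (length-concatMap f xs))

  module _ {n} {G : RawGraph n} (simple : IsSimple G) where

    private
      below : Fin n → Fin n → List (Fin n × Fin n)
      below u v = if (toℕ u <ᵇ toℕ v) ∧ G u v then [ u , v ] else []

      row : Fin n → List (Fin n × Fin n)
      row u = concatMap (below u) (allFin n)

      edges : List (Fin n × Fin n)
      edges = concatMap row (allFin n)

      length-edges : length edges ≡ edgeCount G
      length-edges = trans (length-concatMap row (allFin n)) (cong sum (map-cong
        (λ u → trans (length-concatMap (below u) (allFin n)) (cong sum (map-cong (one u) (allFin n))))
        (allFin n)))
        where
        one : ∀ u v → length (below u v) ≡ (if (toℕ u <ᵇ toℕ v) ∧ G u v then 1 else 0)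
        one u v with (toℕ u <ᵇ toℕ v) ∧ G u v
        ... | true = refl
        ... | false = refl

      edges-edge : All (λ (u , v) → Star (Edge G) u v) edges
      edges-edge = All.concat⁺ (All.map⁺ (All.universal
        (λ u → All.concat⁺ (All.map⁺ (All.universal (one u) (allFin n)))) (allFin n)))
        where
        one : ∀ u v → All (λ (u , v) → Star (Edge G) u v) (below u v)
        one u v with toℕ u <ᵇ toℕ v | G u v in e
        ... | true | true = (e ◅ ε) ∷ []
        ... | true | false = []
        ... | false | _ = []

    -- The classes are generated by a list with one entry per edge, so the size bound of
    -- `union-find` is the source of the n - m components.
    find-components : ∃[ κ ] Components G κ × n ≤ κ + edgeCount G
    find-components with union-find equiv edges edges-edge
      where
      equiv : IsEquiv (Star (Edge G))
      equiv = record { re = ε ; sy = reverse (edge-sym simple) ; tr = _◅◅_ }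
    ... | κ , c , onto , resp , sound , size = κ ,
      record { comp = c ; comp-edge = resp-edge _ _ ; comp-path = sound _ _ ; comp-onto = onto } ,
      subst (λ m → n ≤ κ + m) length-edges size
      where
      resp-below : ∀ u v → All (λ (u , v) → c u ≡ c v) (below u v)
      resp-below u v = All.lookup (All.map⁻ (All.concat⁻
        (All.lookup (All.map⁻ (All.concat⁻ resp)) (∈-allFin u)))) (∈-allFin v)
      resp-< : ∀ u v → toℕ u < toℕ v → Edge G u v → c u ≡ c v
      resp-< u v u<v e with toℕ u <ᵇ toℕ v | <⇒<ᵇ u<v | G u v | e | resp-below u v
      ... | true | _ | true | _ | h ∷ [] = h
      resp-edge : ∀ u v → Edge G u v → c u ≡ c v
      resp-edge u v e with <-cmp (toℕ u) (toℕ v)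
      ... | tri< lt _ _ = resp-< u v lt e
      ... | tri≈ _ eq _ = cong c (toℕ-injective eq)
      ... | tri> _ _ gt = sym (resp-< v u gt (edge-sym simple e))

  -- Embeddings from rotation systems

  trivial : ∀ {N} → IsEquiv {Fin N} (λ _ _ → ⊤)
  trivial = record { re = tt ; sy = λ _ → tt ; tr = λ _ _ → tt }

  module _ {n} {G : RawGraph n} (simple : IsSimple G) {rot : Fin n → Fin n → Fin n}
           (ρ : Rotation G rot) {κ} (K : Components G κ) where
    open Rotation ρ

    comp-reach : ∀ k {d} → Dart G (proj₁ d) (proj₂ d) →
      comp K (proj₁ (iter (step rot) k d)) ≡ comp K (proj₁ d)
    comp-reach zero d = refl
    comp-reach (suc k) {d} h = trans (sym (comp-dart K (iter-closed (step rot)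
      (λ e → Dart G (proj₁ e) (proj₂ e)) (rot-dart ∘ dart-sym simple) k {d} h)))
      (comp-reach k h)

    exact-comp : ∀ {b} (L : Labelling G rot b) → Exact L → ∀ {x y x′ y′} →
      Dart G x y → Dart G x′ y′ → label L x y ≡ label L x′ y′ → comp K x ≡ comp K x′
    exact-comp L exact d d′ e with exact d d′ e
    ... | k , p = trans (sym (comp-reach k d)) (cong (comp K ∘ proj₁) p)

  module FromEmbedding {g n} {G : RawGraph n} (simple : IsSimple G) (E : Embedding g G) where

    rot⁺ : Fin n → Fin n → Fin n
    rot⁺ v u = if G v u then rot E v u else u

    rot⁺-edge : ∀ {v u} → Edge G v u → rot⁺ v u ≡ rot E v u
    rot⁺-edge e rewrite e = refl

    rot⁺-loop : ∀ {v u} → Isolated G v → rot⁺ v u ≡ u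
    rot⁺-loop {v} {u} i rewrite i u = refl

    rotation⁺ : Rotation G rot⁺
    rotation⁺ = record { rot-dart = dart ; rot-reach = reach }
      where
      dart : ∀ {v u} → Dart G v u → Dart G v (rot⁺ v u)
      dart (inj₁ e) rewrite rot⁺-edge e = inj₁ (rot-nbr E _ _ e)
      dart (inj₂ (refl , i)) = inj₂ (sym (rot⁺-loop i) , i)
      same : ∀ k {v u} → Edge G v u →
        iter (rot⁺ v) k u ≡ iter (rot E v) k u × Edge G v (iter (rot E v) k u)
      same zero e = refl , e
      same (suc k) {v} e with same k e
      ... | p , e′ = trans (cong (rot⁺ v) p) (rot⁺-edge e′) , rot-nbr E _ _ e′
      reach : ∀ {v u w} → Dart G v u → Dart G v w → Reach (rot⁺ v) u w
      reach (inj₁ e) (inj₁ e′) with rot-cyc E _ _ _ e e′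
      ... | k , p = k , trans (proj₁ (same k e)) p
      reach (inj₁ e) (inj₂ (_ , i)) = ⊥-elim (isolated-no-edge G i e)
      reach (inj₂ (_ , i)) (inj₁ e) = ⊥-elim (isolated-no-edge G i e)
      reach (inj₂ (p , _)) (inj₂ (q , _)) = 0 , trans (sym p) q

    walk⁺ : Fin n → Fin n → Fin (b E)
    walk⁺ x y = if G x y then walk E x y else iso E x

    walk⁺-edge : ∀ {x y} → Edge G x y → walk⁺ x y ≡ walk E x y
    walk⁺-edge e rewrite e = refl

    walk⁺-loop : ∀ {x y} → Isolated G x → walk⁺ x y ≡ iso E x
    walk⁺-loop {x} {y} i rewrite i y = refl

    labelling⁺ : Labelling G rot⁺ (b E)
    labelling⁺ .label = walk⁺
    labelling⁺ .label-step {x} {y} (inj₁ e) = begin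
      walk⁺ y (rot⁺ y x)    ≡⟨ cong (walk⁺ y) (rot⁺-edge e′) ⟩
      walk⁺ y (rot E y x)   ≡⟨ walk⁺-edge (rot-nbr E _ _ e′) ⟩
      walk E y (rot E y x)  ≡⟨ walk-step E x y e ⟩
      walk E x y            ≡⟨ walk⁺-edge e ⟨
      walk⁺ x y             ∎
      where
      open ≡-Reasoning
      e′ = edge-sym simple e
    labelling⁺ .label-step {x} (inj₂ (refl , i)) = cong (walk⁺ x) (rot⁺-loop i)
    labelling⁺ .label-onto t with walk-sur E t
    ... | inj₁ (x , y , e , p) = x , y , inj₁ e , trans (walk⁺-edge e) p
    ... | inj₂ (x , i , p) = x , x , inj₂ (refl , i) , trans (walk⁺-loop i) p

    exact⁺ : Exact labelling⁺
    exact⁺ (inj₁ e) (inj₁ e′) p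
      with walk-orbit E _ _ _ _ e e′ (trans (sym (walk⁺-edge e)) (trans p (walk⁺-edge e′)))
    ... | k , q = k , trans (proj₁ (same k e)) q
      where
      same : ∀ k {d} → Edge G (proj₁ d) (proj₂ d) → let d′ = iter (step (rot E)) k d in
        iter (step rot⁺) k d ≡ d′ × Edge G (proj₁ d′) (proj₂ d′)
      same zero e = refl , e
      same (suc k) e with same k e
      ... | p , e′ = trans (cong (step rot⁺) p) (cong (_ ,_) (rot⁺-edge (edge-sym simple e′))) ,
        rot-nbr E _ _ (edge-sym simple e′)
    exact⁺ (inj₁ e) (inj₂ (refl , i)) p =
      ⊥-elim (iso-new E _ _ _ i e (trans (sym (walk⁺-loop i)) (trans (sym p) (walk⁺-edge e))))
    exact⁺ (inj₂ (refl , i)) (inj₁ e) p =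
      ⊥-elim (iso-new E _ _ _ i e (trans (sym (walk⁺-loop i)) (trans p (walk⁺-edge e))))
    exact⁺ (inj₂ (refl , i)) (inj₂ (refl , i′)) p
      with iso-inj E _ _ i i′ (trans (sym (walk⁺-loop i)) (trans p (walk⁺-loop i′)))
    ... | refl = 0 , refl

    -- The bipartite graph of components and faces, with one edge per boundary walk, is connected.
    components+faces : ∀ {κ} → Components G κ → κ + f E ≤ 1 + b E
    components+faces {κ} K with union-find trivial
        (map (λ t → comp K (proj₁ (label-onto labelling⁺ t)) ↑ˡ f E , κ ↑ʳ face E t) (allFin (b E)))
        (All.universal (λ _ → tt) _)
    ... | N , c , onto , resp , _ , size =
      ≤-trans size (+-mono-≤ (at-most-one N c onto all-equal)
        (≤-reflexive (trans (length-map _ (allFin (b E))) (length-tabulate id))))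
      where
      at-most-one : ∀ {M} N (c : Fin M → Fin N) → Onto c → (∀ i j → c i ≡ c j) → N ≤ 1
      at-most-one zero _ _ _ = z≤n
      at-most-one (suc zero) _ _ _ = ≤-refl
      at-most-one (suc (suc N)) c onto eq with onto zero | onto (suc zero)
      ... | i , p | j , q with () ← trans (sym p) (trans (eq i j) q)
      node : Fin n ⊎ Fin (f E) → Fin (κ + f E)
      node (inj₁ v) = comp K v ↑ˡ f E
      node (inj₂ j) = κ ↑ʳ j
      incident : ∀ {x y} → Dart G x y → c (node (inj₁ x)) ≡ c (node (inj₂ (face E (walk⁺ x y))))
      incident {x} {y} d = trans
        (cong (λ k → c (k ↑ˡ f E)) (exact-comp simple rotation⁺ K labelling⁺ exact⁺ d
          (proj₁ (proj₂ (proj₂ (label-onto labelling⁺ t))))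
          (sym (proj₂ (proj₂ (proj₂ (label-onto labelling⁺ t)))))))
        (All.lookup (All.map⁻ resp) (∈-allFin t))
        where t = walk⁺ x y
      T : Fin n → Fin (f E) → Set
      T v j = (Isolated G v × face E (iso E v) ≡ j) ⊎
              (∃[ w ] (G v w ≡ true × face E (walk E v w) ≡ j))
      touches : ∀ {v j} → T v j → c (node (inj₁ v)) ≡ c (node (inj₂ j))
      touches (inj₁ (i , refl)) = trans (incident (inj₂ (refl , i)))
        (cong (λ t → c (κ ↑ʳ face E t)) (walk⁺-loop i))
      touches (inj₂ (w , e , refl)) = trans (incident (inj₁ e))
        (cong (λ t → c (κ ↑ʳ face E t)) (walk⁺-edge e))
      link : ∀ {x y} → Link G T x y → c (node x) ≡ c (node y)
      link (edge u v e) = cong (λ k → c (k ↑ˡ f E)) (comp-edge K e)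
      link (vf v j h) = touches h
      link (fv v j h) = sym (touches h)
      is-node : ∀ i → ∃[ x ] node x ≡ i
      is-node i with splitAt κ i in eq
      ... | inj₂ j = inj₂ j , splitAt⁻¹-↑ʳ eq
      ... | inj₁ C with comp-onto K C
      ... | v , refl = inj₁ v , splitAt⁻¹-↑ˡ eq
      all-equal : ∀ i j → c i ≡ c j
      all-equal i j with is-node i | is-node j
      ... | x , refl | y , refl = star-respects (c ∘ node) link (connected E x y)

    -- The number of faces cancels: twice the connectivity bound κ + f ≤ 1 + b, added to Euler's
    -- inequality for the embedding, leaves an inequality in walks and components only.
    embedding⇒weak : Weak g G
    embedding⇒weak with find-components simple
    ... | κ , K , _ = weak rotation⁺ labelling⁺ K
      (+-cancelʳ-≤ (2 + b E + 2 * f E) _ _ (begin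
        m + 2 * κ + (2 + b E + 2 * f E)     ≡⟨ arith₁ m κ (b E) (f E) ⟩
        2 + m + b E + 2 * (κ + f E)         ≤⟨ +-mono-≤ (genus-ok E) (*-monoʳ-≤ 2 (components+faces K)) ⟩
        2 * g + n + 2 * f E + 2 * (1 + b E) ≡⟨ arith₂ (2 * g + n) (b E) (f E) ⟩
        2 * g + n + b E + (2 + b E + 2 * f E) ∎))
      where
      open ≤-Reasoning
      m = edgeCount G
      arith₁ : ∀ m κ b f → m + 2 * κ + (2 + b + 2 * f) ≡ 2 + m + b + 2 * (κ + f)
      arith₁ = solve-∀
      arith₂ : ∀ h b f → h + 2 * f + 2 * (1 + b) ≡ h + b + (2 + b + 2 * f)
      arith₂ = solve-∀

  -- Single-edge components and the common face

  Pair : ∀ {n} → RawGraph n → Fin n → Fin n → Set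
  Pair G u v = Edge G u v × (∀ w → Edge G u w → w ≡ v) × (∀ w → Edge G v w → w ≡ u)

  pair? : ∀ {n} (G : RawGraph n) u v → Dec (Pair G u v)
  pair? G u v = edge? G u v ×-dec
    (all? (λ w → edge? G u w →-dec (w ≟ v)) ×-dec all? (λ w → edge? G v w →-dec (w ≟ u)))

  isolatedCount : ∀ {n} → RawGraph n → ℕ
  isolatedCount G = ∑ (λ v → ⟦ isYes (isolated? G v) ⟧)

  -- In a simple graph each single-edge component is counted twice, once per dart, just as it enters
  -- a face size.
  pairCount : ∀ {n} → RawGraph n → ℕ
  pairCount G = ∑ (λ u → ∑ (λ v → ⟦ isYes (pair? G u v) ⟧))

  -- All components can be placed in one common face: glue along one boundary walk per component
  -- and cap every other boundary walk with a disc.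
  module CommonFace {g n} {G : RawGraph n} (simple : IsSimple G) {rotation : Fin n → Fin n → Fin n}
      (ρ : Rotation G rotation) {b₀} (L : Labelling G rotation b₀) (exact : Exact L)
      {κ₀} (K : Components G (suc κ₀))
      (genus₀ : edgeCount G + 2 * suc κ₀ ≤ 2 * g + n + b₀) where
    open Rotation ρ

    root root′ : Fin (suc κ₀) → Fin n
    root C = proj₁ (comp-onto K C)
    root′ C = proj₁ (a-dart G (root C))

    root-dart : ∀ C → Dart G (root C) (root′ C)
    root-dart C = proj₂ (a-dart G (root C))

    root-comp : ∀ C → comp K (root C) ≡ C
    root-comp C = proj₂ (comp-onto K C)

    ω : Fin (suc κ₀) → Fin b₀
    ω C = label L (root C) (root′ C)

    -- The chosen walk of each further component is identified with that of component `zero`. These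
    -- κ₀ identifications lose at most κ₀ faces, which is exactly what the inequality `genus₀` can
    -- afford.
    gluing : ∃[ f ] Σ (Fin b₀ → Fin f) λ face → Onto face × (∀ C → face (ω C) ≡ face (ω zero)) ×
      b₀ ≤ f + κ₀
    gluing with union-find trivial (map (λ C → ω (suc C) , ω zero) (allFin κ₀))
                  (All.universal (λ _ → tt) _)
    ... | f , face , onto , resp , _ , size = f , face , onto , common ,
      ≤-trans size (≤-reflexive (cong (f +_)
        (trans (length-map _ (allFin κ₀)) (length-tabulate id))))
      where
      common : ∀ C → face (ω C) ≡ face (ω zero)
      common zero = refl
      common (suc C) = All.lookup (All.map⁻ resp) (∈-allFin C)

    f₀ : ℕ
    f₀ = proj₁ gluing

    face₀ : Fin b₀ → Fin f₀
    face₀ = proj₁ (proj₂ gluing)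

    big : Fin f₀
    big = face₀ (ω zero)

    face-ω : ∀ C → face₀ (ω C) ≡ big
    face-ω = proj₁ (proj₂ (proj₂ (proj₂ gluing)))

    edge-dart : ∀ {v w u} → Edge G v w → Dart G v u → Edge G v u
    edge-dart e (inj₁ e′) = e′
    edge-dart e (inj₂ (_ , i)) = ⊥-elim (isolated-no-edge G i e)

    isolated-fixed : ∀ {v} → Isolated G v → ∀ k → iter (step rotation) k (v , v) ≡ (v , v)
    isolated-fixed i zero = refl
    isolated-fixed {v} i (suc k) rewrite isolated-fixed i k with rot-dart {v} {v} (inj₂ (refl , i))
    ... | inj₁ e = ⊥-elim (isolated-no-edge G i e)
    ... | inj₂ (p , _) = cong (v ,_) (sym p)

    T : Fin n → Fin f₀ → Set
    T v j = (Isolated G v × face₀ (label L v v) ≡ j) ⊎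
            (∃[ w ] (G v w ≡ true × face₀ (label L v w) ≡ j))

    dart-touches : ∀ {v w} → Dart G v w → T v (face₀ (label L v w))
    dart-touches {v} {w} (inj₁ e) = inj₂ (w , e , refl)
    dart-touches (inj₂ (refl , i)) = inj₁ (i , refl)

    link-sym : ∀ {x y} → Link G T x y → Link G T y x
    link-sym (edge u v e) = edge v u (edge-sym simple e)
    link-sym (vf v j h) = fv v j h
    link-sym (fv v j h) = vf v j h

    to-big : ∀ x → Star (Link G T) x (inj₂ big)
    to-big (inj₁ v) =
      gmap inj₁ (edge _ _) (comp-path K (sym (root-comp (comp K v)))) ◅◅
      vf _ _ (subst (T _) (face-ω (comp K v)) (dart-touches (root-dart (comp K v)))) ◅ ε
    to-big (inj₂ j) with proj₁ (proj₂ (proj₂ gluing)) j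
    ... | t , refl with label-onto L t
    ... | x , y , d , refl = fv x _ (dart-touches d) ◅ to-big (inj₁ x)

    embedding : Embedding g G
    embedding = record
      { rot = rotation
      ; rot-nbr = λ v u e → edge-dart e (rot-dart (inj₁ e))
      ; rot-cyc = λ v u w e e′ → rot-reach (inj₁ e) (inj₁ e′)
      ; b = b₀
      ; walk = label L
      ; iso = λ v → label L v v
      ; walk-step = λ u v e → label-step L (inj₁ e)
      ; walk-orbit = λ u v u′ v′ e e′ → exact (inj₁ e) (inj₁ e′)
      ; iso-inj = iso-inj′
      ; iso-new = iso-new′
      ; walk-sur = walk-sur′
      ; f = f₀
      ; face = face₀
      ; face-sur = proj₁ (proj₂ (proj₂ gluing))
      ; connected = λ x y → to-big x ◅◅ reverse link-sym (to-big y)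
      ; genus-ok = +-cancelʳ-≤ (2 * κ₀ + b₀) _ _ (begin
          2 + edgeCount G + b₀ + (2 * κ₀ + b₀)        ≡⟨ arith₁ (edgeCount G) b₀ κ₀ ⟩
          edgeCount G + 2 * suc κ₀ + 2 * b₀           ≤⟨ +-mono-≤ genus₀ (*-monoʳ-≤ 2 size) ⟩
          2 * g + n + b₀ + 2 * (f₀ + κ₀)              ≡⟨ arith₂ (2 * g + n) b₀ f₀ κ₀ ⟩
          2 * g + n + 2 * f₀ + (2 * κ₀ + b₀)          ∎)
      }
      where
      open ≤-Reasoning
      size : b₀ ≤ f₀ + κ₀
      size = proj₂ (proj₂ (proj₂ (proj₂ gluing)))
      arith₁ : ∀ m b κ → 2 + m + b + (2 * κ + b) ≡ m + 2 * suc κ + 2 * b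
      arith₁ = solve-∀
      arith₂ : ∀ h b f κ → h + b + 2 * (f + κ) ≡ h + 2 * f + (2 * κ + b)
      arith₂ = solve-∀
      iso-inj′ : ∀ v v′ → Isolated G v → Isolated G v′ → label L v v ≡ label L v′ v′ → v ≡ v′
      iso-inj′ v v′ i i′ e with exact (inj₂ (refl , i)) (inj₂ (refl , i′)) e
      ... | k , p = cong proj₁ (trans (sym (isolated-fixed i k)) p)
      iso-new′ : ∀ v u w → Isolated G v → Edge G u w → label L v v ≢ label L u w
      iso-new′ v u w i e p with exact (inj₂ (refl , i)) (inj₁ e) p
      ... | k , q with trans (sym (isolated-fixed i k)) q
      ... | refl = isolated-no-edge G i e
      walk-sur′ : ∀ t → (∃[ u ] ∃[ v ] (Edge G u v × label L u v ≡ t)) ⊎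
                        (∃[ v ] (Isolated G v × label L v v ≡ t))
      walk-sur′ t with label-onto L t
      ... | x , y , inj₁ e , p = inj₁ (x , y , e , p)
      ... | x , .x , inj₂ (refl , i) , p = inj₂ (x , i , p)

    private
      inBig : Fin n → Fin n → Bool
      inBig u v = G u v ∧ isYes (face₀ (label L u v) ≟ big)

      edge-inBig : ∀ {u v} → Edge G u v → face₀ (label L u v) ≡ big → inBig u v ≡ true
      edge-inBig {u} {v} e p rewrite e = true-isYes (face₀ (label L u v) ≟ big) p

    -- The root of a component is either an isolated vertex or the start of a dart on a glued walk,
    -- and different components have different roots.
    components≤ : suc κ₀ ≤ isolatedCount G + faceSize embedding big
    components≤ = begin
      suc κ₀                                      ≡⟨ trans (∑-const (suc κ₀) 1) (*-identityʳ _) ⟨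
      ∑ {suc κ₀} (λ _ → 1)                        ≤⟨ ∑-mono one ⟩
      ∑ (λ C → isol (root C) + inRow (root C))    ≡⟨ ∑-+ (isol ∘ root) (inRow ∘ root) ⟩
      ∑ (isol ∘ root) + ∑ (inRow ∘ root)          ≤⟨ +-mono-≤ (∑-injective root root-inj isol) (∑-injective root root-inj inRow) ⟩
      isolatedCount G + faceSize embedding big    ∎
      where
      open ≤-Reasoning
      isol inRow : Fin n → ℕ
      isol v = ⟦ isYes (isolated? G v) ⟧
      inRow u = ∑ (λ v → ⟦ inBig u v ⟧)
      root-inj : ∀ C C′ → root C ≡ root C′ → C ≡ C′
      root-inj C C′ e = trans (sym (root-comp C)) (trans (cong (comp K) e) (root-comp C′))
      one : ∀ C → 1 ≤ isol (root C) + inRow (root C)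
      one C with root-dart C
      ... | inj₂ (_ , i) rewrite true-isYes (isolated? G (root C)) i = s≤s z≤n
      ... | inj₁ e = ≤-trans
        (≤-trans (≤-reflexive (cong ⟦_⟧ (sym (edge-inBig e (face-ω C)))))
          (term≤∑ (λ v → ⟦ inBig (root C) v ⟧) (root′ C)))
        (m≤n+m _ _)

    -- A single-edge component has only one boundary walk, running along both sides of the edge.
    -- That walk is therefore the glued one, whichever dart was chosen.
    pairs≤ : pairCount G ≤ faceSize embedding big
    pairs≤ = ∑-mono (λ u → ∑-mono (λ v → ⟦⟧-mono (λ y →
      let p = isYes-true (pair? G u v) y in edge-inBig (proj₁ p) (trans (cong face₀ (in-ω p)) (face-ω _)))))
      where
      pair-star : ∀ {u v x} → Pair G u v → Star (Edge G) u x → x ≡ u ⊎ x ≡ v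
      pair-star p ε = inj₁ refl
      pair-star (e , p , q) (e′ ◅ es) rewrite p _ e′ with pair-star (edge-sym simple e , q , p) es
      ... | inj₁ r = inj₂ r
      ... | inj₂ r = inj₁ r
      only : ∀ {u v s} → Pair G u v → Dart G u s → s ≡ v
      only (_ , p , _) (inj₁ e) = p _ e
      only (e , _) (inj₂ (_ , i)) = ⊥-elim (isolated-no-edge G i e)
      flip : ∀ {u v} → Pair G u v → Pair G v u
      flip (e , p , q) = edge-sym simple e , q , p
      in-ω : ∀ {u v} → Pair G u v → label L u v ≡ ω (comp K u)
      in-ω {u} {v} p with pair-star p (comp-path K (sym (root-comp (comp K u))))
      ... | inj₁ r = sym (cong₂ (label L) r (only p (subst (λ z → Dart G z (root′ (comp K u))) r (root-dart (comp K u)))))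
      ... | inj₂ r = trans
        (sym (trans (sym (label-step L (inj₁ (proj₁ (flip p)))))
          (cong (label L u) (only p (rot-dart (inj₁ (proj₁ p)))))))
        (sym (cong₂ (label L) r (only (flip p) (subst (λ z → Dart G z (root′ (comp K u))) r (root-dart (comp K u))))))

  -- The labelling is first made exact, since the walks of an embedding must be true orbits. The
  -- given vertex guarantees a component whose walk the others can be glued to.
  weak⇒embedding : ∀ {g n} {G : RawGraph n} → IsSimple G → Fin n → Weak g G →
    Σ (Embedding g G) λ E → ∃[ j ]
      (n ≤ edgeCount G + isolatedCount G + faceSize E j × pairCount G ≤ faceSize E j)
  weak⇒embedding {g} {n} {G} simple v (weak {κ′ = zero} ρ L K genus) with () ← comp K v
  weak⇒embedding {g} {n} {G} simple v (weak {κ′ = suc κ₀} ρ L K genus)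
    with RotationProperties.exact-labelling simple ρ | find-components simple
  ... | b* , L* , exact | κ* , K* , size = embedding , big , bound , pairs≤
    where
    open RotationProperties simple ρ using (exact-finest)
    open CommonFace {g} simple ρ L* exact K
      (≤-trans genus (+-monoʳ-≤ (2 * g + n) (exact-finest L L* exact)))
    open ≤-Reasoning
    bound : n ≤ edgeCount G + isolatedCount G + faceSize embedding big
    bound = begin
      n                              ≤⟨ size ⟩
      κ* + edgeCount G               ≤⟨ +-monoˡ-≤ _ (components-most K (comp K*) (comp-onto K*) (comp-edge K*)) ⟩
      suc κ₀ + edgeCount G           ≤⟨ +-monoˡ-≤ _ components≤ ⟩
      isolatedCount G + faceSize embedding big + edgeCount G ≡⟨ +-comm _ (edgeCount G) ⟩
      edgeCount G + (isolatedCount G + faceSize embedding big) ≡⟨ +-assoc (edgeCount G) _ _ ⟨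
      edgeCount G + isolatedCount G + faceSize embedding big ∎

  -- Deleting and adding an edge

  -- One relation serves both halves of a switch: read from `G` to `G′` it is a deletion, read
  -- backwards an addition.
  record OneMore {n} (G G′ : RawGraph n) (p q : Fin n) : Set where
    field
      new : Edge G p q
      old : ¬ Edge G′ p q
      keep : ∀ {u v} → Edge G′ u v → Edge G u v
      split : ∀ {u v} → Edge G u v → Edge G′ u v ⊎ (u ≡ p × v ≡ q) ⊎ (u ≡ q × v ≡ p)
      count : edgeCount G ≡ suc (edgeCount G′)

  identify : ∀ {b} (s t : Fin b) → ∃[ b′ ] Σ (Fin b → Fin b′) λ μ → Onto μ × μ s ≡ μ t × b ≤ suc b′
  identify {b} s t with union-find trivial ((s , t) ∷ []) (tt ∷ [])
  ... | b′ , μ , onto , e ∷ [] , _ , size = b′ , μ , onto , e , subst (b ≤_) (+-comm b′ 1) size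

  star-first : ∀ {A : Set} {T : A → A → Set} {x y} → Star T x y → x ≢ y → ∃[ z ] T x z
  star-first ε ne = ⊥-elim (ne refl)
  star-first (e ◅ _) _ = _ , e

  module Deletion {n} {G G′ : RawGraph n} {p q} (simple : IsSimple G) (simple′ : IsSimple G′)
      (one : OneMore G G′ p q) {rot : Fin n → Fin n → Fin n} (ρ : Rotation G rot) where
    open OneMore one
    open Rotation ρ
    open RotationProperties simple ρ

    p≢q : p ≢ q
    p≢q = edge-≢ simple new

    data End : Fin n → Fin n → Set where
      pq : End p q
      qp : End q p

    end-edge : ∀ {u v} → End u v → Edge G u v
    end-edge pq = new
    end-edge qp = edge-sym simple new

    end-old : ∀ {u v} → End u v → ¬ Edge G′ u v
    end-old pq = old
    end-old qp = old ∘ edge-sym simple′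

    end-unique : ∀ {u v w} → End u v → End u w → v ≡ w
    end-unique pq e = go e refl
      where
      go : ∀ {u w} → End u w → u ≡ p → q ≡ w
      go pq _ = refl
      go qp e = ⊥-elim (p≢q (sym e))
    end-unique qp e = go e refl
      where
      go : ∀ {u w} → End u w → u ≡ q → p ≡ w
      go qp _ = refl
      go pq e = ⊥-elim (p≢q e)

    is-end : ∀ {u v} → Edge G u v → ¬ Edge G′ u v → End u v
    is-end e ne with split e
    ... | inj₁ e′ = ⊥-elim (ne e′)
    ... | inj₂ (inj₁ (refl , refl)) = pq
    ... | inj₂ (inj₂ (refl , refl)) = qp

    still : ∀ {u v w} → End u v → Edge G u w → w ≢ v → Edge G′ u w
    still {u} {w = w} d e ne with edge? G′ u w
    ... | yes e′ = e′
    ... | no ne′ = ⊥-elim (ne (end-unique (is-end e ne′) d))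

    rot-edge : ∀ {v u} → Edge G v u → Edge G v (rot v u)
    rot-edge e with rot-dart (inj₁ e)
    ... | inj₁ e′ = e′
    ... | inj₂ (_ , i) = ⊥-elim (isolated-no-edge G i e)

    -- The deleted dart is cut out of the cyclic order by stepping over it. Outside the edges of
    -- `G′` the map is the identity, which fixes the loop dart of a vertex that has become isolated.
    rot′ : Fin n → Fin n → Fin n
    rot′ v u = if G′ v u then (if G′ v (rot v u) then rot v u else rot v (rot v u)) else u

    data RotView (v u : Fin n) : Set where
      direct : Edge G′ v (rot v u) → rot′ v u ≡ rot v u → RotView v u
      skip : End v (rot v u) → Edge G′ v (rot v (rot v u)) → rot′ v u ≡ rot v (rot v u) →
        RotView v u

    rot-view : ∀ {v u} → Edge G′ v u → RotView v u
    rot-view {v} {u} e with edge? G′ v (rot v u)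
    ... | yes e₁ = direct e₁ eq
      where
      eq : rot′ v u ≡ rot v u
      eq rewrite e | e₁ = refl
    ... | no ne = skip end (still end (rot-edge (end-edge end)) moved) eq
      where
      end = is-end (rot-edge (keep e)) ne
      moved : rot v (rot v u) ≢ rot v u
      moved f = ne (subst (Edge G′ v) (sym (rot-injective (inj₁ (end-edge end)) (inj₁ (keep e)) f)) e)
      eq : rot′ v u ≡ rot v (rot v u)
      eq rewrite e | no-edge G′ ne = refl

    rot′-loop : ∀ {v u} → Isolated G′ v → rot′ v u ≡ u
    rot′-loop {v} {u} i rewrite i u = refl

    rotation′ : Rotation G′ rot′
    rotation′ = record { rot-dart = dart ; rot-reach = reach }
      where
      dart : ∀ {v u} → Dart G′ v u → Dart G′ v (rot′ v u)
      dart (inj₁ e) with rot-view e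
      ... | direct e′ eq = inj₁ (subst (Edge G′ _) (sym eq) e′)
      ... | skip _ e′ eq = inj₁ (subst (Edge G′ _) (sym eq) e′)
      dart (inj₂ (refl , i)) = inj₂ (sym (rot′-loop i) , i)
      go : ∀ k {v u w} → Edge G′ v u → Edge G′ v w → iter (rot v) k u ≡ w → Reach (rot′ v) u w
      go zero e e′ r = 0 , r
      go (suc k) {v} {u} {w} e e′ r with rot-view e | trans (sym (iter-sucˡ (rot v) k u)) r
      go (suc k) {v} e e′ r | direct e₁ eq | r₁ =
        reach-trans (rot′ v) (1 , eq) (go k e₁ e′ r₁)
      -- A skip uses up two steps of `rot v`. With only one left the path would end at the deleted
      -- dart, which is not an edge of `G′`.
      go (suc zero) e e′ r | skip end _ eq | refl = ⊥-elim (end-old end e′)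
      go (suc (suc k)) {v} {u} e e′ r | skip end e₁ eq | r₁ =
        reach-trans (rot′ v) (1 , eq) (go k e₁ e′ (trans (sym (iter-sucˡ (rot v) k (rot v u))) r₁))
      reach : ∀ {v u w} → Dart G′ v u → Dart G′ v w → Reach (rot′ v) u w
      reach (inj₁ e) (inj₁ e′) with rot-reach (inj₁ (keep e)) (inj₁ (keep e′))
      ... | k , r = go k e e′ r
      reach (inj₁ e) (inj₂ (_ , i)) = ⊥-elim (isolated-no-edge G′ i e)
      reach (inj₂ (_ , i)) (inj₁ e) = ⊥-elim (isolated-no-edge G′ i e)
      reach (inj₂ (r , _)) (inj₂ (s , _)) = 0 , trans (sym r) s

    -- If `rot a` fixes `c`, then by transitivity `c` was the only neighbour of `a`; otherwise the
    -- successor of `c` survives.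
    end-remains : ∀ {a c} → End a c → Edge G′ a (rot a c) ⊎ Isolated G′ a
    end-remains {a} {c} d with rot a c ≟ c
    ... | no ne = inj₁ (still d (rot-edge (end-edge d)) ne)
    ... | yes fix = inj₂ (λ w → no-edge G′ (λ e → end-old d (subst (Edge G′ a) (only e) e)))
      where
      constant : ∀ k → iter (rot a) k c ≡ c
      constant zero = refl
      constant (suc k) = trans (cong (rot a) (constant k)) fix
      only : ∀ {w} → Edge G′ a w → w ≡ c
      only e with rot-reach (inj₁ (end-edge d)) (inj₁ (keep e))
      ... | k , r = trans (sym r) (constant k)

    module _ {b} (L : Labelling G rot b) where

      label-turn : ∀ {a c} → End a c → label L a (rot a c) ≡ label L c a
      label-turn d = label-step L (inj₁ (edge-sym simple (end-edge d)))

      -- Stepping over the deleted edge jumps from one of its sides to the other, so labels persist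
      -- once its two sides agree under `μ`. For an edge on a cycle `μ` merges them; for a bridge
      -- they agree already and `μ` is `id`.
      label-step′ : ∀ {A : Set} (μ : Fin b → A) → μ (label L p q) ≡ μ (label L q p) →
        ∀ {x y} → Edge G′ x y → μ (label L y (rot′ y x)) ≡ μ (label L x y)
      label-step′ μ same {x} {y} e with rot-view (edge-sym simple′ e)
      ... | direct _ eq = cong μ (trans (cong (label L y) eq) (label-step L (inj₁ (keep e))))
      ... | skip d _ eq = begin
        μ (label L y (rot′ y x))          ≡⟨ cong (μ ∘ label L y) eq ⟩
        μ (label L y (rot y (rot y x)))   ≡⟨ cong μ (label-turn d) ⟩
        μ (label L (rot y x) y)           ≡⟨ swap d ⟩
        μ (label L y (rot y x))           ≡⟨ cong μ (label-step L (inj₁ (keep e))) ⟩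
        μ (label L x y)                   ∎
        where
        open ≡-Reasoning
        swap : ∀ {a c} → End a c → μ (label L c a) ≡ μ (label L a c)
        swap pq = sym same
        swap qp = same

    module Cycle {b} (L : Labelling G rot b) {κ′} (K′ : Components G′ κ′)
                 (joined : comp K′ p ≡ comp K′ q) where

      not-isolated : ∀ {a c} → End a c → ¬ Isolated G′ a
      not-isolated {a} {c} d i =
        isolated-no-edge G′ i (proj₂ (star-first (comp-path K′ (same d)) (edge-≢ simple (end-edge d))))
        where
        same : ∀ {a c} → End a c → comp K′ a ≡ comp K′ c
        same pq = joined
        same qp = sym joined

      κ′-most : ∀ {κ} → Components G κ → κ′ ≤ κ
      κ′-most K = components-most K (comp K′) (comp-onto K′) respects
        where
        respects : ∀ {u v} → Edge G u v → comp K′ u ≡ comp K′ v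
        respects e with split e
        ... | inj₁ e′ = comp-edge K′ e′
        ... | inj₂ (inj₁ (refl , refl)) = joined
        ... | inj₂ (inj₂ (refl , refl)) = sym joined

      -- Merging the two sides loses at most one label. The merged label is still carried by a dart,
      -- because each end keeps an edge: `p` and `q` remain connected in `G′`.
      merged : ∃[ b′ ] Labelling G′ rot′ b′ × b ≤ suc b′
      merged with identify (label L p q) (label L q p)
      ... | b′ , μ , μ-onto , same , size = b′ , L′ , size
        where
        at-end : ∀ {a c} → End a c → ∃[ x ] ∃[ y ] (Dart G′ x y × μ (label L x y) ≡ μ (label L c a))
        at-end d with end-remains d
        ... | inj₁ e = _ , _ , inj₁ e , cong μ (label-turn L d)
        ... | inj₂ i = ⊥-elim (not-isolated d i)
        L′ : Labelling G′ rot′ b′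
        L′ .label x y = μ (label L x y)
        L′ .label-step (inj₁ e) = label-step′ L μ same e
        L′ .label-step (inj₂ (refl , i)) = cong (λ z → μ (label L _ z)) (rot′-loop i)
        L′ .label-onto t with μ-onto t
        ... | s , refl with label-onto L s
        ... | x , .x , inj₂ (refl , i) , refl =
          x , x , inj₂ (refl , λ v → no-edge G′ (isolated-no-edge G i ∘ keep)) , refl
        ... | x , y , inj₁ e , refl with split e
        ... | inj₁ e′ = x , y , inj₁ e′ , refl
        ... | inj₂ (inj₁ (refl , refl)) = at-end qp
        ... | inj₂ (inj₂ (refl , refl)) = at-end pq

    module Bridge {b} (L : Labelling G rot b) (exact : Exact L) {κ′} (K′ : Components G′ κ′)
                  (parted : comp K′ p ≢ comp K′ q) where

      -- The face walk starting along p q stays on the side of q until it uses the dart q p.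
      same-side : label L p q ≡ label L q p
      same-side with exact (inj₁ (rot-edge (end-edge qp))) (inj₁ new) (label-turn L qp)
      ... | k , r = trans (sym (label-turn L qp)) (go k (rot-edge (end-edge qp)) refl r)
        where
        go : ∀ k {x y} → Edge G x y → comp K′ x ≡ comp K′ q →
          iter (step rot) k (x , y) ≡ (p , q) → label L x y ≡ label L q p
        go zero e c refl = ⊥-elim (parted c)
        go (suc k) {x} {y} e c r with split e
        ... | inj₂ (inj₁ (refl , refl)) = ⊥-elim (parted c)
        ... | inj₂ (inj₂ (refl , refl)) = refl
        ... | inj₁ e′ = trans (sym (label-step L (inj₁ e)))
          (go k (rot-edge (edge-sym simple e)) (trans (sym (comp-edge K′ e′)) c)
            (trans (sym (iter-sucˡ (step rot) k (x , y))) r))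

      w : Fin b
      w = label L p q

      -- The walk `w` runs along both sides of the bridge and falls into two pieces. The piece in
      -- the component of `q` receives the fresh label `zero`; all other labels are shifted by
      -- `suc`.
      side : Fin κ′ → Fin b → Fin (suc b)
      side C t with C ≟ comp K′ q | t ≟ w
      ... | yes _ | yes _ = zero
      ... | _ | _ = suc t

      side-q : ∀ {C} → C ≡ comp K′ q → side C w ≡ zero
      side-q {C} e with C ≟ comp K′ q | w ≟ w
      ... | yes _ | yes _ = refl
      ... | no ne | _ = ⊥-elim (ne e)
      ... | yes _ | no ne = ⊥-elim (ne refl)

      side-p : ∀ {C t} → C ≢ comp K′ q → side C t ≡ suc t
      side-p {C} {t} ne with C ≟ comp K′ q | t ≟ w
      ... | yes e | _ = ⊥-elim (ne e)
      ... | no _ | _ = refl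

      side-other : ∀ {C t} → t ≢ w → side C t ≡ suc t
      side-other {C} {t} ne with C ≟ comp K′ q | t ≟ w
      ... | _ | yes e = ⊥-elim (ne e)
      ... | yes _ | no _ = refl
      ... | no _ | no _ = refl

      -- An end of the bridge may become isolated, and its loop dart, on which `L` says nothing, is
      -- then all that remains of `w` on that side. Hence the default value `w`.
      label₀ : Fin n → Fin n → Fin b
      label₀ x y with dart? G x y
      ... | yes _ = label L x y
      ... | no _ = w

      label₀-dart : ∀ {x y} → Dart G x y → label₀ x y ≡ label L x y
      label₀-dart {x} {y} d with dart? G x y
      ... | yes _ = refl
      ... | no nd = ⊥-elim (nd d)

      label₀-loop : ∀ {a c} → End a c → label₀ a a ≡ w
      label₀-loop {a} d with dart? G a a
      ... | no _ = refl
      ... | yes (inj₁ e) = ⊥-elim (edge-≢ simple e refl)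
      ... | yes (inj₂ (_ , i)) = ⊥-elim (isolated-no-edge G i (end-edge d))

      at-end : ∀ {a c} → End a c → ∃[ y ] (Dart G′ a y × label₀ a y ≡ w)
      at-end {a} {c} d with end-remains d
      ... | inj₁ e = _ , inj₁ e , trans (label₀-dart (inj₁ (keep e))) (trans (label-turn L d) (end-w d))
        where
        end-w : ∀ {a c} → End a c → label L c a ≡ w
        end-w pq = sym same-side
        end-w qp = refl
      ... | inj₂ i = a , inj₂ (refl , i) , label₀-loop d

      split-labelling : Labelling G′ rot′ (suc b)
      split-labelling .label x y = side (comp K′ x) (label₀ x y)
      split-labelling .label-step {x} {y} (inj₁ e) = cong₂ side (sym (comp-edge K′ e)) (begin
        label₀ y (rot′ y x)    ≡⟨ label₀-dart (inj₁ (keep e′)) ⟩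
        label L y (rot′ y x)   ≡⟨ label-step′ L id same-side e ⟩
        label L x y            ≡⟨ label₀-dart (inj₁ (keep e)) ⟨
        label₀ x y             ∎)
        where
        open ≡-Reasoning
        e′ : Edge G′ y (rot′ y x)
        e′ with Rotation.rot-dart rotation′ (inj₁ (edge-sym simple′ e))
        ... | inj₁ e₁ = e₁
        ... | inj₂ (_ , i) = ⊥-elim (isolated-no-edge G′ i (edge-sym simple′ e))
      split-labelling .label-step (inj₂ (refl , i)) =
        cong (λ z → side (comp K′ _) (label₀ _ z)) (rot′-loop i)
      split-labelling .label-onto zero with at-end qp
      ... | y , d , r = q , y , d , trans (cong (side (comp K′ q)) r) (side-q refl)
      split-labelling .label-onto (suc t) with t ≟ w
      ... | yes refl with at-end pq
      ...   | y , d , r = p , y , d , trans (cong (side (comp K′ p)) r) (side-p parted)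
      split-labelling .label-onto (suc t) | no ne with label-onto L t
      ... | x , y , d , refl = x , y , dart′ d , trans (cong (side (comp K′ x)) (label₀-dart d)) (side-other ne)
        where
        dart′ : Dart G x y → Dart G′ x y
        dart′ (inj₂ (refl , i)) = inj₂ (refl , λ v → no-edge G′ (isolated-no-edge G i ∘ keep))
        dart′ (inj₁ e) with split e
        ... | inj₁ e′ = inj₁ e′
        ... | inj₂ (inj₁ (refl , refl)) = ⊥-elim (ne refl)
        ... | inj₂ (inj₂ (refl , refl)) = ⊥-elim (ne (sym same-side))

      κ′-most : ∀ {κ} → Components G κ → κ′ ≤ suc κ
      κ′-most K = most K′ parted
        where
        most : ∀ {κ′} (K′ : Components G′ κ′) → comp K′ p ≢ comp K′ q → κ′ ≤ suc _
        most {zero} _ _ = z≤n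
        most {suc k} K′ parted with merge (comp K′ p) (comp K′ q) parted
        ... | μ , same , μ-onto , _ = s≤s (components-most K (μ ∘ comp K′) onto respects)
          where
          onto : Onto (μ ∘ comp K′)
          onto j with μ-onto j
          ... | C , refl with comp-onto K′ C
          ... | v , refl = v , refl
          respects : ∀ {u v} → Edge G u v → μ (comp K′ u) ≡ μ (comp K′ v)
          respects e with split e
          ... | inj₁ e′ = cong μ (comp-edge K′ e′)
          ... | inj₂ (inj₁ (refl , refl)) = same
          ... | inj₂ (inj₂ (refl , refl)) = sym same

  -- The balance of m + 2κ against b: on a cycle m falls by one, b by at most one, and κ does not
  -- grow. At a bridge m falls by one, κ grows by at most one, and b grows by one. Exactness enters
  -- in the bridge case, where the two sides must lie on one orbit.
  delete-edge : ∀ {g n} {G G′ : RawGraph n} {p q} → IsSimple G → IsSimple G′ → OneMore G G′ p q →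
    Weak g G → Weak g G′
  delete-edge {g} {n} {G} {G′} {p} {q} simple simple′ one (weak {κ′ = κ} ρ L₀ K genus)
    with RotationProperties.exact-labelling simple ρ | find-components simple′
  ... | b , L , exact | κ′ , K′ , _ = result (comp K′ p ≟ comp K′ q)
    where
    open Deletion simple simple′ one ρ
    open RotationProperties simple ρ using (exact-finest)
    open ≤-Reasoning
    m′ = edgeCount G′
    X = 2 * g + n
    genus′ : suc m′ + 2 * κ ≤ X + b
    genus′ = subst (λ m → m + 2 * κ ≤ X + b) (OneMore.count one)
      (≤-trans genus (+-monoʳ-≤ X (exact-finest L₀ L exact)))
    result : Dec (comp K′ p ≡ comp K′ q) → Weak g G′
    result (yes joined) = let (b′ , L′ , size) = merged in
      weak rotation′ L′ K′ (+-cancelˡ-≤ 1 _ _ (begin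
        suc (m′ + 2 * κ′)    ≤⟨ s≤s (+-monoʳ-≤ m′ (*-monoʳ-≤ 2 (κ′-most K))) ⟩
        suc m′ + 2 * κ       ≤⟨ genus′ ⟩
        X + b                ≤⟨ +-monoʳ-≤ X size ⟩
        X + suc b′           ≡⟨ +-suc X b′ ⟩
        suc (X + b′)         ∎))
      where open Cycle L K′ joined
    result (no parted) = weak rotation′ split-labelling K′ (begin
        m′ + 2 * κ′          ≤⟨ +-monoʳ-≤ m′ (*-monoʳ-≤ 2 (κ′-most K)) ⟩
        m′ + 2 * suc κ       ≡⟨ arith m′ κ ⟩
        suc (suc m′ + 2 * κ) ≤⟨ s≤s genus′ ⟩
        suc (X + b)          ≡⟨ +-suc X b ⟨
        X + suc b            ∎)
      where
      open Bridge L exact K′ parted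
      arith : ∀ m κ → m + 2 * suc κ ≡ suc (suc m + 2 * κ)
      arith = solve-∀

  module Addition {n} {G G′ : RawGraph n} {p q} (simple : IsSimple G) (simple′ : IsSimple G′)
      (one : OneMore G G′ p q) (p-isolated : Isolated G′ p) (q-isolated : Isolated G′ q) where
    open OneMore one

    p≢q : p ≢ q
    p≢q = edge-≢ simple new

    isolated-old : ∀ {v} → Isolated G v → Isolated G′ v
    isolated-old i v = no-edge G′ (isolated-no-edge G i ∘ keep)

    module _ {rot : Fin n → Fin n → Fin n} (ρ : Rotation G′ rot) where
      open Rotation ρ

      rot⁺ : Fin n → Fin n → Fin n
      rot⁺ v u = if G′ v u then rot v u else u

      rot⁺-edge : ∀ {v u} → Edge G′ v u → rot⁺ v u ≡ rot v u
      rot⁺-edge e rewrite e = refl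

      rot⁺-fix : ∀ {v u} → G′ v u ≡ false → rot⁺ v u ≡ u
      rot⁺-fix e rewrite e = refl

      rot-edge : ∀ {v u} → Edge G′ v u → Edge G′ v (rot v u)
      rot-edge e with rot-dart (inj₁ e)
      ... | inj₁ e′ = e′
      ... | inj₂ (_ , i) = ⊥-elim (isolated-no-edge G′ i e)

      rotation⁺ : Rotation G rot⁺
      rotation⁺ = record { rot-dart = dart ; rot-reach = reach }
        where
        dart : ∀ {v u} → Dart G v u → Dart G v (rot⁺ v u)
        dart (inj₂ (refl , i)) = inj₂ (sym (rot⁺-fix (isolated-old i _)) , i)
        dart {v} {u} (inj₁ e) with edge? G′ v u
        ... | yes e′ = inj₁ (subst (Edge G v) (sym (rot⁺-edge e′)) (keep (rot-edge e′)))
        ... | no ne = inj₁ (subst (Edge G v) (sym (rot⁺-fix (no-edge G′ ne))) e)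
        same : ∀ k {v u} → Edge G′ v u →
          iter (rot⁺ v) k u ≡ iter (rot v) k u × Edge G′ v (iter (rot v) k u)
        same zero e = refl , e
        same (suc k) {v} e with same k e
        ... | r , e′ = trans (cong (rot⁺ v) r) (rot⁺-edge e′) , rot-edge e′
        reach : ∀ {v u w} → Dart G v u → Dart G v w → Reach (rot⁺ v) u w
        reach (inj₁ e) (inj₁ e′) with split e | split e′
        ... | inj₁ f | inj₁ f′ with rot-reach (inj₁ f) (inj₁ f′)
        ...   | k , r = k , trans (proj₁ (same k f)) r
        reach (inj₁ e) (inj₁ e′) | inj₁ f | inj₂ (inj₁ (refl , _)) =
          ⊥-elim (isolated-no-edge G′ p-isolated f)
        reach (inj₁ e) (inj₁ e′) | inj₁ f | inj₂ (inj₂ (refl , _)) =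
          ⊥-elim (isolated-no-edge G′ q-isolated f)
        reach (inj₁ e) (inj₁ e′) | inj₂ (inj₁ (refl , _)) | inj₁ f =
          ⊥-elim (isolated-no-edge G′ p-isolated f)
        reach (inj₁ e) (inj₁ e′) | inj₂ (inj₂ (refl , _)) | inj₁ f =
          ⊥-elim (isolated-no-edge G′ q-isolated f)
        reach (inj₁ e) (inj₁ e′) | inj₂ (inj₁ (_ , refl)) | inj₂ (inj₁ (_ , refl)) = 0 , refl
        reach (inj₁ e) (inj₁ e′) | inj₂ (inj₁ (r , _)) | inj₂ (inj₂ (s , _)) =
          ⊥-elim (p≢q (trans (sym r) s))
        reach (inj₁ e) (inj₁ e′) | inj₂ (inj₂ (r , _)) | inj₂ (inj₁ (s , _)) =
          ⊥-elim (p≢q (trans (sym s) r))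
        reach (inj₁ e) (inj₁ e′) | inj₂ (inj₂ (_ , refl)) | inj₂ (inj₂ (_ , refl)) = 0 , refl
        reach (inj₁ e) (inj₂ (_ , i)) = ⊥-elim (isolated-no-edge G i e)
        reach (inj₂ (_ , i)) (inj₁ e) = ⊥-elim (isolated-no-edge G i e)
        reach (inj₂ (r , _)) (inj₂ (s , _)) = 0 , trans (sym r) s

      -- The empty walks around `p` and `q` turn into the single walk along both sides of the new
      -- edge.
      labelling⁺ : ∀ {b} → Labelling G′ rot b → ∃[ b′ ] Labelling G rot⁺ b′ × b ≤ suc b′
      labelling⁺ L with identify (label L p p) (label L q q)
      ... | b′ , μ , μ-onto , same , size = b′ , L⁺ , size
        where
        lab : Fin n → Fin n → Fin b′
        lab u v = μ (if G′ u v then label L u v else label L u u)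
        lab-edge : ∀ {u v} → Edge G′ u v → lab u v ≡ μ (label L u v)
        lab-edge e rewrite e = refl
        lab-loop : ∀ {u v} → G′ u v ≡ false → lab u v ≡ μ (label L u u)
        lab-loop e rewrite e = refl
        L⁺ : Labelling G rot⁺ b′
        L⁺ .label = lab
        L⁺ .label-step (inj₂ (refl , i)) = cong (lab _) (rot⁺-fix (isolated-old i _))
        L⁺ .label-step {x} {y} (inj₁ e) with split e
        ... | inj₁ e′ = begin
          lab y (rot⁺ y x)          ≡⟨ cong (lab y) (rot⁺-edge (edge-sym simple′ e′)) ⟩
          lab y (rot y x)           ≡⟨ lab-edge (rot-edge (edge-sym simple′ e′)) ⟩
          μ (label L y (rot y x))   ≡⟨ cong μ (label-step L (inj₁ e′)) ⟩
          μ (label L x y)           ≡⟨ lab-edge e′ ⟨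
          lab x y                   ∎
          where open ≡-Reasoning
        ... | inj₂ (inj₁ (refl , refl)) = trans (cong (lab q) (rot⁺-fix (q-isolated p)))
          (trans (lab-loop (q-isolated p)) (trans (sym same) (sym (lab-loop (p-isolated q)))))
        ... | inj₂ (inj₂ (refl , refl)) = trans (cong (lab p) (rot⁺-fix (p-isolated q)))
          (trans (lab-loop (p-isolated q)) (trans same (sym (lab-loop (q-isolated p)))))
        L⁺ .label-onto t with μ-onto t
        ... | s , refl with label-onto L s
        ... | x , y , inj₁ e , refl = x , y , inj₁ (keep e) , lab-edge e
        ... | x , .x , inj₂ (refl , i) , refl with x ≟ p | x ≟ q
        ... | yes refl | _ = p , q , inj₁ new , lab-loop (p-isolated q)
        ... | no _ | yes refl = q , p , inj₁ (edge-sym simple new) , lab-loop (q-isolated p)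
        ... | no x≢p | no x≢q = x , x , inj₂ (refl , λ v → no-edge G (none v)) , lab-loop (i x)
          where
          none : ∀ v → ¬ Edge G x v
          none v e with split e
          ... | inj₁ e′ = isolated-no-edge G′ i e′
          ... | inj₂ (inj₁ (r , _)) = x≢p r
          ... | inj₂ (inj₂ (r , _)) = x≢q r

    components⁺ : ∀ {κ} → Components G′ κ → ∃[ k ] Components G k × suc k ≡ κ
    components⁺ {zero} K with () ← comp K p
    components⁺ {suc k} K with merge (comp K p) (comp K q) parted
      where
      parted : comp K p ≢ comp K q
      parted e = isolated-no-edge G′ p-isolated (proj₂ (star-first (comp-path K e) p≢q))
    ... | μ , same , μ-onto , reflect = k , record
      { comp = μ ∘ comp K
      ; comp-edge = respects
      ; comp-path = path
      ; comp-onto = onto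
      } , refl
      where
      onto : Onto (μ ∘ comp K)
      onto j with μ-onto j
      ... | C , refl with comp-onto K C
      ... | v , refl = v , refl
      respects : ∀ {u v} → Edge G u v → μ (comp K u) ≡ μ (comp K v)
      respects e with split e
      ... | inj₁ e′ = cong μ (comp-edge K e′)
      ... | inj₂ (inj₁ (refl , refl)) = same
      ... | inj₂ (inj₂ (refl , refl)) = sym same
      lift : ∀ {u v} → comp K u ≡ comp K v → Star (Edge G) u v
      lift e = gmap id keep (comp-path K e)
      path : ∀ {u v} → μ (comp K u) ≡ μ (comp K v) → Star (Edge G) u v
      path {u} {v} e with reflect _ _ e
      ... | inj₁ r = lift r
      ... | inj₂ (inj₁ (r , s)) = lift r ◅◅ new ◅ lift (sym s)
      ... | inj₂ (inj₂ (r , s)) = lift r ◅◅ edge-sym simple new ◅ lift (sym s)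

  -- One edge more and one component fewer lower m + 2κ by one, which pays for the at most one lost
  -- walk.
  add-edge : ∀ {g n} {G G′ : RawGraph n} {p q} → IsSimple G → IsSimple G′ → OneMore G G′ p q →
    Isolated G′ p → Isolated G′ q → Weak g G′ → Weak g G
  add-edge {g} {n} {G} {G′} simple simple′ one ip iq (weak {b′ = b} ρ L K genus)
    with Addition.labelling⁺ simple simple′ one ip iq ρ L | Addition.components⁺ simple simple′ one ip iq K
  ... | b⁺ , L⁺ , size | k , K⁺ , refl = weak (rotation⁺ ρ) L⁺ K⁺ (+-cancelˡ-≤ 1 _ _ (begin
        suc (edgeCount G + 2 * k)         ≡⟨ cong (λ m → suc (m + 2 * k)) (OneMore.count one) ⟩
        suc (suc m′ + 2 * k)              ≡⟨ arith m′ k ⟩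
        m′ + 2 * suc k                    ≤⟨ genus ⟩
        X + b                             ≤⟨ +-monoʳ-≤ X size ⟩
        X + suc b⁺                        ≡⟨ +-suc X b⁺ ⟩
        suc (X + b⁺)                      ∎))
    where
    open Addition simple simple′ one ip iq
    open ≤-Reasoning
    m′ = edgeCount G′
    X = 2 * g + n
    arith : ∀ m κ → suc (suc m + 2 * κ) ≡ m + 2 * suc κ
    arith = solve-∀

  -- Deciding whether a graph embeds

  funToFin-cong : ∀ {m n} {f g : Fin m → Fin n} → (∀ i → f i ≡ g i) → funToFin f ≡ funToFin g
  funToFin-cong {zero} h = refl
  funToFin-cong {suc m} h = cong₂ combine (h zero) (funToFin-cong (h ∘ suc))

  -- Exhaustive search runs over numeric codes of binary functions. Decoding recovers a function
  -- only pointwise, so the properties that are searched for have to be transported along pointwise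
  -- equality.
  table : ∀ {k n} → Fin ((k ^ n) ^ n) → Fin n → Fin n → Fin k
  table {k} {n} c u v = finToFun {k} {n} (finToFun {k ^ n} {n} c u) v

  tabulate² : ∀ {k n} → (Fin n → Fin n → Fin k) → Fin ((k ^ n) ^ n)
  tabulate² f = funToFin (λ u → funToFin (f u))

  table-tabulate² : ∀ {k n} (f : Fin n → Fin n → Fin k) u v → table (tabulate² f) u v ≡ f u v
  table-tabulate² {k} {n} f u v =
    trans (cong (λ c → finToFun {k} {n} c v) (finToFun-funToFin (λ u → funToFin (f u)) u))
          (finToFun-funToFin (f u) v)

  tabulate²-cong : ∀ {k n} {f g : Fin n → Fin n → Fin k} → (∀ u v → f u v ≡ g u v) →
    tabulate² f ≡ tabulate² g
  tabulate²-cong h = funToFin-cong (λ u → funToFin-cong (h u))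

  tabulate²-table : ∀ {k n} (c : Fin ((k ^ n) ^ n)) → tabulate² (table {k} {n} c) ≡ c
  tabulate²-table {k} {n} c = trans
    (funToFin-cong (λ u → funToFin-finToFin {n} {k} (finToFun {k ^ n} {n} c u)))
    (funToFin-finToFin {n} {k ^ n} c)

  edgeCount-cong : ∀ {n} {G H : RawGraph n} → G ≗G H → edgeCount G ≡ edgeCount H
  edgeCount-cong eq =
    ∑-cong (λ u → ∑-cong (λ v → cong (λ e → ⟦ (toℕ u <ᵇ toℕ v) ∧ e ⟧) (eq u v)))

  module _ {n} {G H : RawGraph n} (eq : G ≗G H) where

    edge-to : ∀ {u v} → Edge G u v → Edge H u v
    edge-to {u} {v} = trans (sym (eq u v))

    edge-from : ∀ {u v} → Edge H u v → Edge G u v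
    edge-from {u} {v} = trans (eq u v)

    isolated-to : ∀ {v} → Isolated G v → Isolated H v
    isolated-to {v} i u = trans (sym (eq v u)) (i u)

    isolated-from : ∀ {v} → Isolated H v → Isolated G v
    isolated-from {v} i u = trans (eq v u) (i u)

    dart-to : ∀ {u v} → Dart G u v → Dart H u v
    dart-to (inj₁ e) = inj₁ (edge-to e)
    dart-to (inj₂ (p , i)) = inj₂ (p , isolated-to i)

    dart-from : ∀ {u v} → Dart H u v → Dart G u v
    dart-from (inj₁ e) = inj₁ (edge-from e)
    dart-from (inj₂ (p , i)) = inj₂ (p , isolated-from i)

    weak-resp : ∀ {g} → Weak g G → Weak g H
    weak-resp {g} (weak {κ′ = κ} ρ L K genus) = weak
      (record
        { rot-dart = dart-to ∘ Rotation.rot-dart ρ ∘ dart-from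
        ; rot-reach = λ d d′ → Rotation.rot-reach ρ (dart-from d) (dart-from d′) })
      (record
        { label = label L
        ; label-step = label-step L ∘ dart-from
        ; label-onto = λ t → let (x , y , d , e) = label-onto L t in x , y , dart-to d , e })
      (record
        { comp = comp K
        ; comp-edge = comp-edge K ∘ edge-from
        ; comp-path = gmap id edge-to ∘ comp-path K
        ; comp-onto = comp-onto K })
      (subst (λ m → m + 2 * κ ≤ _) (edgeCount-cong eq) genus)

  module _ {n} {G : RawGraph n} {rot rot₂ : Fin n → Fin n → Fin n}
           (eq : ∀ v u → rot v u ≡ rot₂ v u) where

    rotation-resp : Rotation G rot → Rotation G rot₂
    rotation-resp ρ = record
      { rot-dart = λ {v} {u} d → subst (Dart G v) (eq v u) (Rotation.rot-dart ρ d)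
      ; rot-reach = λ {v} {u} d d′ → let (k , e) = Rotation.rot-reach ρ d d′ in
          k , trans (sym (iter-cong (eq v) k u)) e }

    labelling-resp : ∀ {b} → Labelling G rot b → Labelling G rot₂ b
    labelling-resp L = record
      { label = label L
      ; label-step = λ {x} {y} d → trans (cong (label L y) (sym (eq y x))) (label-step L d)
      ; label-onto = label-onto L }

  rotation? : ∀ {n} (G : RawGraph n) rot → Dec (Rotation G rot)
  rotation? G rot = map′
    (λ (h , h′) → record { rot-dart = h _ _ ; rot-reach = h′ _ _ _ })
    (λ ρ → (λ _ _ → Rotation.rot-dart ρ) , (λ _ _ _ → Rotation.rot-reach ρ))
    (all? (λ v → all? (λ u → dart? G v u →-dec dart? G v (rot v u))) ×-dec
     all? (λ v → all? (λ u → all? (λ w → dart? G v u →-dec (dart? G v w →-dec reach? (rot v) u w)))))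

  module _ (g : ℕ) {n} {G : RawGraph n} (simple : IsSimple G) {κ} (K : Components G κ) where

    Realises : (Fin n → Fin n → Fin n) → Set
    Realises rot = Rotation G rot × ∃[ b ] (Labelling G rot b × edgeCount G + 2 * κ ≤ 2 * g + n + b)

    -- For a fixed rotation system the exact labelling has the most labels, so testing it alone
    -- settles the existence of any suitable labelling.
    realises? : ∀ rot → Dec (Realises rot)
    realises? rot with rotation? G rot
    ... | no nρ = no (nρ ∘ proj₁)
    ... | yes ρ with RotationProperties.exact-labelling simple ρ
    ... | b , L , exact with edgeCount G + 2 * κ ≤? 2 * g + n + b
    ... | yes le = yes (ρ , b , L , le)
    ... | no nle = no λ (_ , b₂ , L₂ , le₂) → nle (≤-trans le₂
          (+-monoʳ-≤ (2 * g + n) (RotationProperties.exact-finest simple ρ L₂ L exact)))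

  weak? : ∀ g {n} {G : RawGraph n} → IsSimple G → Dec (Weak g G)
  weak? g {n} {G} simple with find-components simple
  ... | κ , K , _ = map′ to from (any? (λ c → realises? g simple K (table c)))
    where
    to : ∃[ c ] Realises g simple K (table c) → Weak g G
    to (c , ρ , b , L , genus) = weak ρ L K genus
    from : Weak g G → ∃[ c ] Realises g simple K (table c)
    from (weak {rot} {b} ρ L K₂ genus) = tabulate² rot , rotation-resp same ρ , b , labelling-resp same L ,
      ≤-trans (+-monoʳ-≤ (edgeCount G)
        (*-monoʳ-≤ 2 (components-most K₂ (comp K) (comp-onto K) (comp-edge K)))) genus
      where
      same : ∀ v u → rot v u ≡ table (tabulate² rot) v u
      same v u = sym (table-tabulate² rot v u)

  simple? : ∀ {n} (G : RawGraph n) → Dec (IsSimple G)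
  simple? G = all? (λ u → all? (λ v → G u v Bool.≟ G v u)) ×-dec all? (λ v → G v v Bool.≟ false)

  -- The switch

  δ : ∀ {n} → Fin n → Fin n → ℕ
  δ a v = ⟦ isYes (v ≟ a) ⟧

  δ-refl : ∀ {n} (a : Fin n) → δ a a ≡ 1
  δ-refl a = cong ⟦_⟧ (true-isYes (a ≟ a) refl)

  ∑-δ : ∀ {n} (a : Fin n) → ∑ (δ a) ≡ 1
  ∑-δ a = ≤-antisym
    (∑-unique (λ v → isYes (v ≟ a)) (λ i j p q → trans (isYes-true (i ≟ a) p) (sym (isYes-true (j ≟ a) q))))
    (≤-trans (≤-reflexive (sym (δ-refl a))) (term≤∑ (δ a) a))

  <ᵇ-true : ∀ {m n} → m < n → (m <ᵇ n) ≡ true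
  <ᵇ-true {m} {n} h with m <ᵇ n | <⇒<ᵇ h
  ... | true | _ = refl

  <ᵇ-false : ∀ {m n} → n < m → (m <ᵇ n) ≡ false
  <ᵇ-false {m} {n} h with m <ᵇ n in eq
  ... | false = refl
  ... | true = ⊥-elim (<-asym h (<ᵇ⇒< m n (subst Data.Bool.T (sym eq) tt)))

  -- Diagonal entries are allowed because the bound is also applied to `both-isolated`, whose
  -- diagonal marks the isolated vertices.
  handshake : ∀ {n} (G : RawGraph n) → (∀ u v → G u v ≡ G v u) →
    ∑ (λ u → ∑ (λ v → ⟦ G u v ⟧)) ≤ 2 * edgeCount G + ∑ (λ u → ⟦ G u u ⟧)
  handshake {n} G symm = begin
    ∑ (λ u → ∑ (λ v → ⟦ G u v ⟧))
      ≤⟨ ∑-mono (λ u → ∑-mono (λ v → bound u v)) ⟩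
    ∑ (λ u → ∑ (λ v → up u v + up v u + δ u v * ⟦ G u u ⟧))
      ≡⟨ ∑-cong (λ u → trans (∑-+ (λ v → up u v + up v u) (λ v → δ u v * ⟦ G u u ⟧))
           (cong₂ _+_ (∑-+ (up u) (λ v → up v u)) (diagonal u))) ⟩
    ∑ (λ u → ∑ (up u) + ∑ (λ v → up v u) + ⟦ G u u ⟧)
      ≡⟨ ∑-+ (λ u → ∑ (up u) + ∑ (λ v → up v u)) (λ u → ⟦ G u u ⟧) ⟩
    ∑ (λ u → ∑ (up u) + ∑ (λ v → up v u)) + loops
      ≡⟨ cong (_+ loops) (∑-+ (λ u → ∑ (up u)) (λ u → ∑ (λ v → up v u))) ⟩
    edgeCount G + ∑ (λ u → ∑ (λ v → up v u)) + loops
      ≡⟨ cong (λ s → edgeCount G + s + loops) (∑-swap {n} {n} (λ u v → up v u)) ⟩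
    edgeCount G + edgeCount G + loops
      ≡⟨ cong (λ s → edgeCount G + s + loops) (+-identityʳ (edgeCount G)) ⟨
    2 * edgeCount G + loops ∎
    where
    open ≤-Reasoning
    up : Fin n → Fin n → ℕ
    up u v = ⟦ (toℕ u <ᵇ toℕ v) ∧ G u v ⟧
    loops = ∑ (λ u → ⟦ G u u ⟧)
    diagonal : ∀ u → ∑ (λ v → δ u v * ⟦ G u u ⟧) ≡ ⟦ G u u ⟧
    diagonal u = trans (∑-*ʳ (δ u) ⟦ G u u ⟧) (trans (cong (_* ⟦ G u u ⟧) (∑-δ u)) (*-identityˡ _))
    bound : ∀ u v → ⟦ G u v ⟧ ≤ up u v + up v u + δ u v * ⟦ G u u ⟧
    bound u v with <-cmp (toℕ u) (toℕ v)
    ... | tri< lt _ _ rewrite <ᵇ-true lt = ≤-trans (m≤m+n _ (up v u)) (m≤m+n _ _)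
    ... | tri> _ _ gt rewrite <ᵇ-true gt =
      ≤-trans (≤-reflexive (cong ⟦_⟧ (symm u v))) (≤-trans (m≤n+m _ (up u v)) (m≤m+n _ _))
    ... | tri≈ _ eq _ with toℕ-injective eq
    ... | refl rewrite δ-refl u | *-identityˡ ⟦ G u u ⟧ = m≤n+m _ _

  one-more : ∀ {n} {G G′ : RawGraph n} {p q} → IsSimple G → IsSimple G′ → toℕ p < toℕ q →
    Edge G p q → G′ p q ≡ false →
    (∀ u v → (u ≡ p × v ≡ q) ⊎ (u ≡ q × v ≡ p) ⊎ G u v ≡ G′ u v) → OneMore G G′ p q
  one-more {n} {G} {G′} {p} {q} simple simple′ p<q e ne agree = record
    { new = e
    ; old = λ e′ → false≢true (trans (sym ne) e′)
    ; keep = keep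
    ; split = split
    ; count = begin
        edgeCount G
          ≡⟨ ∑-cong (λ u → trans (∑-cong (term u)) (∑-+ (up G′ u) (λ v → δ q v * δ p u))) ⟩
        ∑ (λ u → ∑ (up G′ u) + ∑ (λ v → δ q v * δ p u))
          ≡⟨ ∑-+ (λ u → ∑ (up G′ u)) (λ u → ∑ (λ v → δ q v * δ p u)) ⟩
        edgeCount G′ + ∑ (λ u → ∑ (λ v → δ q v * δ p u))
          ≡⟨ cong (edgeCount G′ +_) (trans (∑-cong row) (∑-δ p)) ⟩
        edgeCount G′ + 1
          ≡⟨ +-comm (edgeCount G′) 1 ⟩
        suc (edgeCount G′) ∎
    }
    where
    open ≡-Reasoning
    up : RawGraph n → Fin n → Fin n → ℕ
    up H u v = ⟦ (toℕ u <ᵇ toℕ v) ∧ H u v ⟧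
    row : ∀ u → ∑ (λ v → δ q v * δ p u) ≡ δ p u
    row u = trans (∑-*ʳ (δ q) (δ p u)) (trans (cong (_* δ p u) (∑-δ q)) (*-identityˡ _))
    keep : ∀ {u v} → Edge G′ u v → Edge G u v
    keep {u} {v} e′ with agree u v
    ... | inj₁ (refl , refl) = e
    ... | inj₂ (inj₁ (refl , refl)) = edge-sym simple e
    ... | inj₂ (inj₂ s) = trans s e′
    split : ∀ {u v} → Edge G u v → Edge G′ u v ⊎ (u ≡ p × v ≡ q) ⊎ (u ≡ q × v ≡ p)
    split {u} {v} e′ with agree u v
    ... | inj₁ s = inj₂ (inj₁ s)
    ... | inj₂ (inj₁ s) = inj₂ (inj₂ s)
    ... | inj₂ (inj₂ s) = inj₁ (trans (sym s) e′)
    term : ∀ u v → up G u v ≡ up G′ u v + δ q v * δ p u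
    term u v with agree u v
    term .p .q | inj₁ (refl , refl) rewrite <ᵇ-true p<q | e | ne | δ-refl p | δ-refl q = refl
    term .q .p | inj₂ (inj₁ (refl , refl)) rewrite <ᵇ-false p<q with p ≟ q
    ... | yes refl = ⊥-elim (<-irrefl refl p<q)
    ... | no _ = refl
    term u v | inj₂ (inj₂ s) rewrite s with u ≟ p | v ≟ q
    ... | yes refl | yes refl = ⊥-elim (false≢true (trans (sym ne) (trans (sym s) e)))
    ... | no _ | yes _ = sym (+-identityʳ _)
    ... | yes _ | no _ = sym (+-identityʳ _)
    ... | no _ | no _ = sym (+-identityʳ _)

  flips? : ∀ {n} (p q u v : Fin n) → Dec ((u ≡ p × v ≡ q) ⊎ (u ≡ q × v ≡ p))
  flips? p q u v = ((u ≟ p) ×-dec (v ≟ q)) ⊎-dec ((u ≟ q) ×-dec (v ≟ p))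

  -- Flipping is used for deletion and addition alike, since it is undone by flipping again: for
  -- fixed vertices the switch is injective on all graphs, with no side conditions.
  toggle : ∀ {n} → Fin n → Fin n → RawGraph n → RawGraph n
  toggle p q G u v = if isYes (flips? p q u v) then not (G u v) else G u v

  toggle-injective : ∀ {n} (p q : Fin n) {G H : RawGraph n} → toggle p q G ≗G toggle p q H → G ≗G H
  toggle-injective p q eq u v with isYes (flips? p q u v) | eq u v
  ... | true | e = Bool.not-injective e
  ... | false | e = e

  toggle-at : ∀ {n} (p q : Fin n) (G : RawGraph n) → toggle p q G p q ≡ not (G p q)
  toggle-at p q G rewrite true-isYes (flips? p q p q) (inj₁ (refl , refl)) = refl

  toggle-agree : ∀ {n} (p q : Fin n) (G : RawGraph n) u v →
    (u ≡ p × v ≡ q) ⊎ (u ≡ q × v ≡ p) ⊎ G u v ≡ toggle p q G u v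
  toggle-agree p q G u v with flips? p q u v
  ... | yes (inj₁ s) = inj₁ s
  ... | yes (inj₂ s) = inj₂ (inj₁ s)
  ... | no _ = inj₂ (inj₂ refl)

  toggle-simple : ∀ {n} {p q : Fin n} {G : RawGraph n} → p ≢ q → IsSimple G → IsSimple (toggle p q G)
  toggle-simple {p = p} {q} {G} p≢q (symm , irr) = symm′ , irr′
    where
    symm′ : ∀ u v → toggle p q G u v ≡ toggle p q G v u
    symm′ u v with flips? p q u v | flips? p q v u
    ... | yes _ | yes _ = cong not (symm u v)
    ... | no _ | no _ = symm u v
    ... | yes (inj₁ (a , b)) | no n = ⊥-elim (n (inj₂ (b , a)))
    ... | yes (inj₂ (a , b)) | no n = ⊥-elim (n (inj₁ (b , a)))
    ... | no n | yes (inj₁ (a , b)) = ⊥-elim (n (inj₂ (b , a)))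
    ... | no n | yes (inj₂ (a , b)) = ⊥-elim (n (inj₁ (b , a)))
    irr′ : ∀ v → toggle p q G v v ≡ false
    irr′ v with flips? p q v v
    ... | yes (inj₁ (a , b)) = ⊥-elim (p≢q (trans (sym a) b))
    ... | yes (inj₂ (a , b)) = ⊥-elim (p≢q (trans (sym b) a))
    ... | no _ = irr v

  <⇒≢F : ∀ {n} {p q : Fin n} → toℕ p < toℕ q → p ≢ q
  <⇒≢F lt refl = <-irrefl refl lt

  module Switch {n} {G : RawGraph n} {p q x y : Fin n} (simple : IsSimple G) (p<q : toℕ p < toℕ q)
      (x<y : toℕ x < toℕ y) (pq : Edge G p q) (ix : Isolated G x) (iy : Isolated G y) where

    G₁ G₂ : RawGraph n
    G₁ = toggle p q G
    G₂ = toggle x y G₁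

    simple₁ : IsSimple G₁
    simple₁ = toggle-simple (<⇒≢F p<q) simple

    simple₂ : IsSimple G₂
    simple₂ = toggle-simple (<⇒≢F x<y) simple₁

    removed : OneMore G G₁ p q
    removed = one-more simple simple₁ p<q pq (trans (toggle-at p q G) (cong not pq)) (toggle-agree p q G)

    open OneMore removed renaming (keep to keep₁; split to split₁)

    isolated₁ : ∀ {v} → Isolated G v → Isolated G₁ v
    isolated₁ i w = no-edge G₁ (isolated-no-edge G i ∘ keep₁)

    added : OneMore G₂ G₁ x y
    added = one-more simple₂ simple₁ x<y (trans (toggle-at x y G₁) (cong not (isolated₁ ix y)))
      (isolated₁ ix y) (λ u v → flip (toggle-agree x y G₁ u v))
      where
      flip : ∀ {u v} {A B : Set} → A ⊎ B ⊎ G₁ u v ≡ G₂ u v → A ⊎ B ⊎ G₂ u v ≡ G₁ u v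
      flip (inj₁ a) = inj₁ a
      flip (inj₂ (inj₁ b)) = inj₂ (inj₁ b)
      flip (inj₂ (inj₂ c)) = inj₂ (inj₂ (sym c))

    open OneMore added renaming (keep to keep₂; split to split₂; new to new₂)

    edgeCount₂ : edgeCount G₂ ≡ edgeCount G
    edgeCount₂ = trans (OneMore.count added) (sym (OneMore.count removed))

    weak₂ : ∀ {g} → Weak g G → Weak g G₂
    weak₂ W = add-edge simple₂ simple₁ added (isolated₁ ix) (isolated₁ iy)
      (delete-edge simple simple₁ removed W)

    pair₂ : Pair G₂ x y
    pair₂ = new₂ , (λ w → at-x) , (λ w → at-y)
      where
      at-x : ∀ {w} → Edge G₂ x w → w ≡ y
      at-x e with split₂ e
      ... | inj₁ e′ = ⊥-elim (isolated-no-edge G₁ (isolated₁ ix) e′)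
      ... | inj₂ (inj₁ (_ , r)) = r
      ... | inj₂ (inj₂ (r , _)) = ⊥-elim (<⇒≢F x<y r)
      at-y : ∀ {w} → Edge G₂ y w → w ≡ x
      at-y e with split₂ e
      ... | inj₁ e′ = ⊥-elim (isolated-no-edge G₁ (isolated₁ iy) e′)
      ... | inj₂ (inj₁ (r , _)) = ⊥-elim (<⇒≢F x<y (sym r))
      ... | inj₂ (inj₂ (_ , r)) = r

    Touched : Fin n → Set
    Touched u = (u ≡ x ⊎ u ≡ y) ⊎ (u ≡ p ⊎ u ≡ q)

    touched? : ∀ u → Dec (Touched u)
    touched? u = ((u ≟ x) ⊎-dec (u ≟ y)) ⊎-dec ((u ≟ p) ⊎-dec (u ≟ q))

    ∑-touched : ∑ (λ u → ⟦ isYes (touched? u) ⟧) ≤ 4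
    ∑-touched = begin
      ∑ (λ u → ⟦ isYes (touched? u) ⟧)                      ≤⟨ ∑-mono one ⟩
      ∑ (λ u → (δ x u + δ y u) + (δ p u + δ q u))           ≡⟨ ∑-+ (λ u → δ x u + δ y u) (λ u → δ p u + δ q u) ⟩
      ∑ (λ u → δ x u + δ y u) + ∑ (λ u → δ p u + δ q u)     ≡⟨ cong₂ _+_ (∑-+ (δ x) (δ y)) (∑-+ (δ p) (δ q)) ⟩
      (∑ (δ x) + ∑ (δ y)) + (∑ (δ p) + ∑ (δ q))             ≡⟨ cong₂ _+_ (cong₂ _+_ (∑-δ x) (∑-δ y)) (cong₂ _+_ (∑-δ p) (∑-δ q)) ⟩
      4                                                     ∎
      where
      open ≤-Reasoning
      one : ∀ u → ⟦ isYes (touched? u) ⟧ ≤ (δ x u + δ y u) + (δ p u + δ q u)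
      one u with u ≟ x | u ≟ y | u ≟ p | u ≟ q
      ... | yes _ | _ | _ | _ = s≤s z≤n
      ... | no _ | yes _ | _ | _ = s≤s z≤n
      ... | no _ | no _ | yes _ | _ = s≤s z≤n
      ... | no _ | no _ | no _ | yes _ = s≤s z≤n
      ... | no _ | no _ | no _ | no _ = z≤n

    isolatedCount₂ : isolatedCount G ≤ 2 + isolatedCount G₂
    isolatedCount₂ = begin
      isolatedCount G                                       ≤⟨ ∑-mono one ⟩
      ∑ (λ v → (δ x v + δ y v) + isol₂ v)                   ≡⟨ ∑-+ (λ v → δ x v + δ y v) isol₂ ⟩
      ∑ (λ v → δ x v + δ y v) + isolatedCount G₂            ≡⟨ cong (_+ isolatedCount G₂) (trans (∑-+ (δ x) (δ y)) (cong₂ _+_ (∑-δ x) (∑-δ y))) ⟩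
      2 + isolatedCount G₂                                  ∎
      where
      open ≤-Reasoning
      isol₂ : Fin n → ℕ
      isol₂ v = ⟦ isYes (isolated? G₂ v) ⟧
      one : ∀ v → ⟦ isYes (isolated? G v) ⟧ ≤ (δ x v + δ y v) + isol₂ v
      one v = cases (v ≟ x) (v ≟ y)
        where
        none : v ≢ x → v ≢ y → Isolated G v → ∀ {w} → ¬ Edge G₂ v w
        none v≢x v≢y i e with split₂ e
        ... | inj₁ e′ = isolated-no-edge G i (keep₁ e′)
        ... | inj₂ (inj₁ (r , _)) = v≢x r
        ... | inj₂ (inj₂ (r , _)) = v≢y r
        cases : Dec (v ≡ x) → Dec (v ≡ y) → ⟦ isYes (isolated? G v) ⟧ ≤ (δ x v + δ y v) + isol₂ v
        cases (yes refl) _ = ≤-trans (⟦⟧≤1 _) (≤-trans (≤-reflexive (sym (δ-refl x)))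
          (≤-trans (m≤m+n (δ x x) (δ y x)) (m≤m+n _ _)))
        cases (no _) (yes refl) = ≤-trans (⟦⟧≤1 _) (≤-trans (≤-reflexive (sym (δ-refl y)))
          (≤-trans (m≤n+m (δ y y) (δ x y)) (m≤m+n _ _)))
        cases (no v≢x) (no v≢y) = ≤-trans (⟦⟧-mono (λ t → true-isYes (isolated? G₂ v)
          (λ w → no-edge G₂ {v} {w} (none v≢x v≢y (isYes-true (isolated? G v) t) {w})))) (m≤n+m _ _)

    untouched-pair : ∀ {u v} → ¬ Touched u → ¬ Touched v → Pair G₂ u v → Pair G u v
    untouched-pair {u} {v} nu nv (e , only-u , only-v) =
      old-edge , (λ w → only-u w ∘ still nu) , (λ w → only-v w ∘ still nv)
      where
      old-edge : Edge G u v
      old-edge with split₂ e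
      ... | inj₁ e′ = keep₁ e′
      ... | inj₂ (inj₁ (r , _)) = ⊥-elim (nu (inj₁ (inj₁ r)))
      ... | inj₂ (inj₂ (r , _)) = ⊥-elim (nu (inj₁ (inj₂ r)))
      still : ∀ {a w} → ¬ Touched a → Edge G a w → Edge G₂ a w
      still na e with split₁ e
      ... | inj₁ e′ = keep₂ e′
      ... | inj₂ (inj₁ (r , _)) = ⊥-elim (na (inj₂ (inj₁ r)))
      ... | inj₂ (inj₂ (r , _)) = ⊥-elim (na (inj₂ (inj₂ r)))

    -- A pair that is new must contain one of the four vertices of the switch. Each of these is the
    -- first vertex of at most one pair and the second of at most one, hence 4 + 4.
    pairCount₂ : pairCount G₂ ≤ 8 + pairCount G
    pairCount₂ = begin
      pairCount G₂
        ≤⟨ ∑-mono (λ u → ∑-mono (one u)) ⟩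
      ∑ (λ u → ∑ (λ v → (P₂ u v * t u + P₂ u v * t v) + P u v))
        ≡⟨ ∑-cong (λ u → trans (∑-+ (λ v → P₂ u v * t u + P₂ u v * t v) (P u))
             (cong (_+ ∑ (P u)) (∑-+ (λ v → P₂ u v * t u) (λ v → P₂ u v * t v)))) ⟩
      ∑ (λ u → (∑ (λ v → P₂ u v * t u) + ∑ (λ v → P₂ u v * t v)) + ∑ (P u))
        ≡⟨ ∑-+ (λ u → ∑ (λ v → P₂ u v * t u) + ∑ (λ v → P₂ u v * t v)) (λ u → ∑ (P u)) ⟩
      ∑ (λ u → ∑ (λ v → P₂ u v * t u) + ∑ (λ v → P₂ u v * t v)) + pairCount G
        ≡⟨ cong (_+ pairCount G) (∑-+ (λ u → ∑ (λ v → P₂ u v * t u)) (λ u → ∑ (λ v → P₂ u v * t v))) ⟩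
      (∑ (λ u → ∑ (λ v → P₂ u v * t u)) + ∑ (λ u → ∑ (λ v → P₂ u v * t v))) + pairCount G
        ≡⟨ cong (λ s → (∑ (λ u → ∑ (λ v → P₂ u v * t u)) + s) + pairCount G) (∑-swap {n} {n} (λ u v → P₂ u v * t v)) ⟩
      (∑ (λ u → ∑ (λ v → P₂ u v * t u)) + ∑ (λ v → ∑ (λ u → P₂ u v * t v))) + pairCount G
        ≤⟨ +-monoˡ-≤ (pairCount G) (+-mono-≤
             (four (λ u v → pair? G₂ u v) (λ u v w (_ , only , _) (e , _) → sym (only w e)))
             (four (λ v u → pair? G₂ u v) (λ u v w (_ , _ , only) (e , _) → sym (only w (edge-sym simple₂ {w} {u} e))))) ⟩
      8 + pairCount G ∎
      where
      open ≤-Reasoning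
      P P₂ : Fin n → Fin n → ℕ
      P u v = ⟦ isYes (pair? G u v) ⟧
      P₂ u v = ⟦ isYes (pair? G₂ u v) ⟧
      t : Fin n → ℕ
      t u = ⟦ isYes (touched? u) ⟧
      one : ∀ u v → P₂ u v ≤ (P₂ u v * t u + P₂ u v * t v) + P u v
      one u v with touched? u | touched? v
      ... | yes _ | _ = ≤-trans (≤-reflexive (sym (*-identityʳ (P₂ u v)))) (≤-trans (m≤m+n _ _) (m≤m+n _ _))
      ... | no _ | yes _ = ≤-trans (≤-reflexive (sym (*-identityʳ (P₂ u v)))) (≤-trans (m≤n+m _ (P₂ u v * 0)) (m≤m+n _ _))
      ... | no nu | no nv = ≤-trans (⟦⟧-mono (λ s → true-isYes (pair? G u v)
          (untouched-pair nu nv (isYes-true (pair? G₂ u v) s)))) (m≤n+m _ _)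
      four : {Q : Fin n → Fin n → Set} (Q? : ∀ u v → Dec (Q u v)) →
        (∀ u v w → Q u v → Q u w → v ≡ w) → ∑ (λ u → ∑ (λ v → ⟦ isYes (Q? u v) ⟧ * t u)) ≤ 4
      four Q? unique = begin
        ∑ (λ u → ∑ (λ v → ⟦ isYes (Q? u v) ⟧ * t u))
          ≡⟨ ∑-cong (λ u → ∑-*ʳ (λ v → ⟦ isYes (Q? u v) ⟧) (t u)) ⟩
        ∑ (λ u → ∑ (λ v → ⟦ isYes (Q? u v) ⟧) * t u)
          ≤⟨ ∑-mono (λ u → *-monoˡ-≤ (t u) (∑-unique (λ v → isYes (Q? u v)) (λ v w a b →
               unique u v w (isYes-true (Q? u v) a) (isYes-true (Q? u w) b)))) ⟩
        ∑ (λ u → 1 * t u)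
          ≡⟨ ∑-cong (λ u → *-identityˡ (t u)) ⟩
        ∑ t
          ≤⟨ ∑-touched ⟩
        4 ∎

  -- Double counting

  bit : Fin 2 → Bool
  bit zero = false
  bit (suc _) = true

  unbit : Bool → Fin 2
  unbit false = zero
  unbit true = suc zero

  bit-unbit : ∀ b → bit (unbit b) ≡ b
  bit-unbit false = refl
  bit-unbit true = refl

  unbit-bit : ∀ i → unbit (bit i) ≡ i
  unbit-bit zero = refl
  unbit-bit (suc zero) = refl

  graph : ∀ {n} → Fin ((2 ^ n) ^ n) → RawGraph n
  graph {n} c u v = bit (table {2} {n} c u v)

  code : ∀ {n} → RawGraph n → Fin ((2 ^ n) ^ n)
  code {n} G = tabulate² {2} {n} (λ u v → unbit (G u v))

  graph-code : ∀ {n} (G : RawGraph n) → graph (code G) ≗G G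
  graph-code {n} G u v =
    trans (cong bit (table-tabulate² {2} {n} (λ u v → unbit (G u v)) u v)) (bit-unbit (G u v))

  code-cong : ∀ {n} {G H : RawGraph n} → G ≗G H → code G ≡ code H
  code-cong {n} eq = tabulate²-cong {2} {n} (λ u v → cong unbit (eq u v))

  code-graph : ∀ {n} (c : Fin ((2 ^ n) ^ n)) → code (graph {n} c) ≡ c
  code-graph {n} c =
    trans (tabulate²-cong {2} {n} (λ u v → unbit-bit (table {2} {n} c u v))) (tabulate²-table {2} {n} c)

  code-injective : ∀ {n} {G H : RawGraph n} → code G ≡ code H → G ≗G H
  code-injective {G = G} {H} e u v =
    trans (sym (graph-code G u v)) (trans (cong (λ c → graph c u v) e) (graph-code H u v))

  ⟦isYes⟧-cong : ∀ {A B : Set} (a : Dec A) (b : Dec B) → (A → B) → (B → A) → ⟦ isYes a ⟧ ≡ ⟦ isYes b ⟧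
  ⟦isYes⟧-cong a b f g = ≤-antisym (⟦⟧-mono (true-isYes b ∘ f ∘ isYes-true a))
                                   (⟦⟧-mono (true-isYes a ∘ g ∘ isYes-true b))

  module _ {n} {G H : RawGraph n} (eq : G ≗G H) where

    isolatedCount-cong : isolatedCount G ≡ isolatedCount H
    isolatedCount-cong = ∑-cong (λ v → ⟦isYes⟧-cong (isolated? G v) (isolated? H v)
      (isolated-to {G = G} {H} eq) (isolated-from {G = G} {H} eq))

    pairCount-cong : pairCount G ≡ pairCount H
    pairCount-cong = ∑-cong (λ u → ∑-cong (λ v → ⟦isYes⟧-cong (pair? G u v) (pair? H u v)
      (λ (e , p , q) → to e , (λ w → p w ∘ from) , (λ w → q w ∘ from))
      (λ (e , p , q) → from e , (λ w → p w ∘ to) , (λ w → q w ∘ to))))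
      where
      to : ∀ {u v} → Edge G u v → Edge H u v
      to = edge-to {G = G} {H} eq
      from : ∀ {u v} → Edge H u v → Edge G u v
      from = edge-from {G = G} {H} eq

    simple-resp : IsSimple G → IsSimple H
    simple-resp (symm , irr) =
      (λ u v → trans (sym (eq u v)) (trans (symm u v) (eq v u))) , (λ v → trans (sym (eq v v)) (irr v))

  both-isolated : ∀ {n} → RawGraph n → RawGraph n
  both-isolated G x y = isYes (isolated? G x) ∧ isYes (isolated? G y)

  ∧-true : ∀ {a b} → a ∧ b ≡ true → a ≡ true × b ≡ true
  ∧-true {true} {true} _ = refl , refl

  ⟦∧⟧ : ∀ a b → ⟦ a ∧ b ⟧ ≡ ⟦ a ⟧ * ⟦ b ⟧
  ⟦∧⟧ true b = sym (+-identityʳ _)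
  ⟦∧⟧ false b = refl

  <ᵇ-< : ∀ {m n} → (m <ᵇ n) ≡ true → m < n
  <ᵇ-< {m} {n} e = <ᵇ⇒< m n (subst Data.Bool.T (sym e) tt)

  -- With i isolated vertices, the ordered pairs of distinct ones number i² - i, which is at least
  -- w² once i exceeds w.
  isolated-pairs : ∀ {n} (G : RawGraph n) {w} → w < isolatedCount G →
    w * w ≤ 2 * edgeCount (both-isolated G)
  isolated-pairs {n} G {w} w<i with m≤n⇒∃[o]m+o≡n w<i
  ... | r , e = +-cancelʳ-≤ i _ _ (begin
    w * w + i                                     ≤⟨ square ⟩
    i * i                                         ≡⟨ product ⟨
    ∑ (λ x → ∑ (λ y → ⟦ J x y ⟧))                 ≤⟨ handshake J (λ x y → Bool.∧-comm (ι x) (ι y)) ⟩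
    2 * edgeCount J + ∑ (λ x → ⟦ J x x ⟧)         ≡⟨ cong (2 * edgeCount J +_) (∑-cong (λ x → cong ⟦_⟧ (Bool.∧-idem (ι x)))) ⟩
    2 * edgeCount J + i                           ∎)
    where
    open ≤-Reasoning
    i = isolatedCount G
    J = both-isolated G
    ι : Fin n → Bool
    ι x = isYes (isolated? G x)
    product : ∑ (λ x → ∑ (λ y → ⟦ J x y ⟧)) ≡ i * i
    product = trans (∑-cong (λ x → trans (∑-cong (λ y → ⟦∧⟧ (ι x) (ι y))) (∑-*ˡ ⟦ ι x ⟧ (λ y → ⟦ ι y ⟧))))
                    (∑-*ʳ (λ x → ⟦ ι x ⟧) i)
    square : w * w + i ≤ i * i
    square = begin
      w * w + i                          ≡⟨ cong (w * w +_) e ⟨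
      w * w + (suc w + r)                ≤⟨ m≤m+n _ _ ⟩
      w * w + (suc w + r) + (w + 2 * w * r + r * r + r) ≡⟨ arith w r ⟩
      (suc w + r) * (suc w + r)          ≡⟨ cong₂ _*_ e e ⟩
      i * i                              ∎
      where
      arith : ∀ w r → w * w + (suc w + r) + (w + 2 * w * r + r * r + r) ≡ (suc w + r) * (suc w + r)
      arith = solve-∀

  ∑∑-*ʳ : ∀ {n} (f : Fin n → Fin n → ℕ) k →
    ∑ (λ x → ∑ (λ y → f x y * k)) ≡ ∑ (λ x → ∑ (f x)) * k
  ∑∑-*ʳ f k = trans (∑-cong (λ x → ∑-*ʳ (f x) k)) (∑-*ʳ (λ x → ∑ (f x)) k)

  ∑∑-*ˡ : ∀ {n} k (f : Fin n → Fin n → ℕ) →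
    ∑ (λ x → ∑ (λ y → k * f x y)) ≡ k * ∑ (λ x → ∑ (f x))
  ∑∑-*ˡ k f = trans (∑-cong (λ x → ∑-*ˡ k (f x))) (∑-*ˡ k (λ x → ∑ (f x)))

  ∑-swap₂ : ∀ {N n} (f : Fin N → Fin n → Fin n → ℕ) →
    ∑ (λ c → ∑ (λ x → ∑ (f c x))) ≡ ∑ (λ x → ∑ (λ y → ∑ (λ c → f c x y)))
  ∑-swap₂ {N} {n} f = trans (∑-swap {N} {n} (λ c x → ∑ (f c x)))
    (∑-cong (λ x → ∑-swap {N} {n} (λ c y → f c x y)))

  module Counting (g n m : ℕ) where

    Codes : ℕ
    Codes = (2 ^ n) ^ n

    gr : Fin Codes → RawGraph n
    gr = graph {n}

    -- Graphs of the second kind with movable thresholds: a switch lowers `w` by 2 and raises `β` by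
    -- 8.
    Bad : ℕ → ℕ → RawGraph n → Set
    Bad w β G = IsSimple G × edgeCount G ≡ m × Weak g G × w < isolatedCount G × pairCount G ≤ β

    bad-resp : ∀ {w β G H} → G ≗G H → Bad w β G → Bad w β H
    bad-resp {w} {β} {G} {H} eq (s , e , W , i , p) =
      simple-resp {G = G} {H} eq s , trans (sym (edgeCount-cong {G = G} {H} eq)) e , weak-resp eq W ,
      subst (w <_) (isolatedCount-cong {G = G} {H} eq) i , subst (_≤ β) (pairCount-cong {G = G} {H} eq) p

    bad? : ∀ w β G → Dec (Bad w β G)
    bad? w β G with simple? G
    ... | no ns = no (ns ∘ proj₁)
    ... | yes s with (edgeCount G ℕ.≟ m) ×-dec (weak? g s ×-dec ((w <? isolatedCount G) ×-dec (pairCount G ≤? β)))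
    ... | yes rest = yes (s , rest)
    ... | no nrest = no (nrest ∘ proj₂)

    isBad : ℕ → ℕ → Fin Codes → Bool
    isBad w β c = isYes (bad? w β (gr c))

    count : ℕ → ℕ → ℕ
    count w β = ∑ (λ c → ⟦ isBad w β c ⟧)

    switch : (p q x y : Fin n) → Fin Codes → Fin Codes
    switch p q x y c = code (toggle x y (toggle p q (gr c)))

    switch-injective : ∀ p q x y c d → switch p q x y c ≡ switch p q x y d → c ≡ d
    switch-injective p q x y c d e = begin
      c               ≡⟨ code-graph {n} c ⟨
      code (gr c)  ≡⟨ code-cong {G = gr c} {gr d} (toggle-injective p q {gr c} {gr d}
                          (toggle-injective x y {toggle p q (gr c)} {toggle p q (gr d)} (code-injective e))) ⟩
      code (gr d)  ≡⟨ code-graph {n} d ⟩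
      d               ∎
      where open ≡-Reasoning

    switch-bad : ∀ {w β p q x y c} → Bad (2 + w) β (gr c) →
      toℕ p < toℕ q → Edge (gr c) p q → toℕ x < toℕ y →
      Isolated (gr c) x → Isolated (gr c) y →
      Bad w (8 + β) (gr (switch p q x y c)) × Pair (gr (switch p q x y c)) x y
    switch-bad {w} {β} {p} {q} {x} {y} {c} (s , e , W , i , k) p<q pq x<y ix iy =
      bad-resp {w} {8 + β} back
        (simple₂ , trans edgeCount₂ e , weak₂ W ,
         +-cancelˡ-≤ 2 _ _ (≤-trans i isolatedCount₂) , ≤-trans pairCount₂ (+-monoʳ-≤ 8 k)) ,
      (trans (sym (back x y)) new , (λ u → at-x u ∘ trans (back x u)) , (λ u → at-y u ∘ trans (back y u)))
      where
      open Switch {G = gr c} s p<q x<y pq ix iy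
      G₃ = gr (switch p q x y c)
      back : G₂ ≗G G₃
      back u v = sym (graph-code G₂ u v)
      new = proj₁ pair₂
      at-x = proj₁ (proj₂ pair₂)
      at-y = proj₂ (proj₂ pair₂)

    module _ (w β : ℕ) where

      private
        B B′ : Fin Codes → ℕ
        B c = ⟦ isBad (2 + w) β c ⟧
        B′ c = ⟦ isBad w (8 + β) c ⟧
        up : RawGraph n → Fin n → Fin n → ℕ
        up G u v = ⟦ (toℕ u <ᵇ toℕ v) ∧ G u v ⟧
        pr : Fin Codes → Fin n → Fin n → ℕ
        pr c x y = ⟦ isYes (pair? (gr c) x y) ⟧
        M : Fin n → Fin n → Fin n → Fin n → Fin Codes → ℕ
        M p q x y c = B c * (up (gr c) p q * up (both-isolated (gr c)) x y)

        fit : ∀ a b d e f → (a ≡ true → b ≡ true → d ≡ true → e ≡ true × f ≡ true) →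
          ⟦ a ⟧ * (⟦ b ⟧ * ⟦ d ⟧) ≤ ⟦ e ⟧ * ⟦ f ⟧
        fit false b d e f h = z≤n
        fit true false d e f h = z≤n
        fit true true false e f h = z≤n
        fit true true true e f h with h refl refl refl
        ... | refl , refl = ≤-refl

        move : ∀ p q x y c → M p q x y c ≤ B′ (switch p q x y c) * pr (switch p q x y c) x y
        move p q x y c = fit (isBad (2 + w) β c) _ _ (isBad w (8 + β) c′) (isYes (pair? (gr c′) x y)) λ a b d →
          let (p<q , pq) = ∧-true b
              (x<y , ij) = ∧-true d
              (ix , iy) = ∧-true ij
              (bad , pair) = switch-bad {w} {β} {p} {q} {x} {y} {c} (isYes-true (bad? (2 + w) β (gr c)) a) (<ᵇ-< p<q) pq (<ᵇ-< x<y)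
                (isYes-true (isolated? (gr c) x) ix) (isYes-true (isolated? (gr c) y) iy)
          in true-isYes (bad? w (8 + β) (gr c′)) bad , true-isYes (pair? (gr c′) x y) pair
          where c′ = switch p q x y c

        moves-from : ∀ c → ∑ (λ p → ∑ (λ q → ∑ (λ x → ∑ (λ y → M p q x y c)))) ≡
          B c * (edgeCount (gr c) * edgeCount (both-isolated (gr c)))
        moves-from c = begin
          ∑ (λ p → ∑ (λ q → ∑ (λ x → ∑ (λ y → B c * (U p q * V x y)))))
            ≡⟨ ∑-cong (λ p → ∑-cong (λ q → trans (∑∑-*ˡ (B c) (λ x y → U p q * V x y))
                 (cong (B c *_) (∑∑-*ˡ (U p q) V)))) ⟩
          ∑ (λ p → ∑ (λ q → B c * (U p q * J)))
            ≡⟨ ∑∑-*ˡ (B c) (λ p q → U p q * J) ⟩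
          B c * ∑ (λ p → ∑ (λ q → U p q * J))
            ≡⟨ cong (B c *_) (∑∑-*ʳ U J) ⟩
          B c * (edgeCount (gr c) * J) ∎
          where
          open ≡-Reasoning
          U V : Fin n → Fin n → ℕ
          U = up (gr c)
          V = up (both-isolated (gr c))
          J = edgeCount (both-isolated (gr c))

        many-moves : ∀ c → B c * (m * (w * w)) ≤ 2 * (B c * (edgeCount (gr c) * edgeCount (both-isolated (gr c))))
        many-moves c with bad? (2 + w) β (gr c)
        ... | no _ = z≤n
        ... | yes (_ , e , _ , i , _) rewrite e = begin
          1 * (m * (w * w))       ≤⟨ *-monoʳ-≤ 1 (*-monoʳ-≤ m (isolated-pairs (gr c) (≤-trans (s≤s (m≤n+m w 2)) i))) ⟩
          1 * (m * (2 * J))       ≡⟨ arith m J ⟩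
          2 * (1 * (m * J))       ∎
          where
          open ≤-Reasoning
          J = edgeCount (both-isolated (gr c))
          arith : ∀ m J → 1 * (m * (2 * J)) ≡ 2 * (1 * (m * J))
          arith = solve-∀

        few-returns : ∀ c → B′ c * pairCount (gr c) ≤ B′ c * (8 + β)
        few-returns c with bad? w (8 + β) (gr c)
        ... | no _ = z≤n
        ... | yes (_ , _ , _ , _ , k) = *-monoʳ-≤ 1 k

      -- Both sides estimate the number of switches (p, q, x, y, c). Each source graph has m edges
      -- to delete and at least w²/2 pairs to join. In the target the joined pair is a single-edge
      -- component, so there are at most 8 + β choices for it.
      double-count : count (2 + w) β * (m * (w * w)) ≤ 2 * (n * (n * (count w (8 + β) * (8 + β))))
      double-count = begin
        count (2 + w) β * (m * (w * w))
          ≡⟨ ∑-*ʳ B (m * (w * w)) ⟨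
        ∑ (λ c → B c * (m * (w * w)))
          ≤⟨ ∑-mono many-moves ⟩
        ∑ (λ c → 2 * (B c * (edgeCount (gr c) * edgeCount (both-isolated (gr c)))))
          ≡⟨ ∑-*ˡ 2 (λ c → B c * (edgeCount (gr c) * edgeCount (both-isolated (gr c)))) ⟩
        2 * ∑ (λ c → B c * (edgeCount (gr c) * edgeCount (both-isolated (gr c))))
          ≡⟨ cong (2 *_) (∑-cong moves-from) ⟨
        2 * ∑ (λ c → ∑ (λ p → ∑ (λ q → ∑ (λ x → ∑ (λ y → M p q x y c)))))
          ≡⟨ cong (2 *_) (trans (∑-swap₂ (λ c p q → ∑ (λ x → ∑ (λ y → M p q x y c))))
               (∑-cong (λ p → ∑-cong (λ q → ∑-swap₂ (λ c x y → M p q x y c))))) ⟩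
        2 * ∑ (λ p → ∑ (λ q → ∑ (λ x → ∑ (λ y → ∑ (M p q x y)))))
          ≤⟨ *-monoʳ-≤ 2 (∑-mono (λ p → ∑-mono (λ q → ∑-mono (λ x → ∑-mono (λ y →
               ≤-trans (∑-mono (move p q x y))
                 (∑-injective (switch p q x y) (switch-injective p q x y) (λ c → B′ c * pr c x y))))))) ⟩
        -- By injectivity the sum over sources became one over targets. Its terms do not depend on
        -- `p` and `q`, so the position of the deleted edge costs the crude factor n².
        2 * ∑ {n} (λ p → ∑ {n} (λ q → ∑ (λ x → ∑ (λ y → ∑ (λ c → B′ c * pr c x y)))))
          ≡⟨ cong (2 *_) (trans (∑-cong {n} (λ p → ∑-const n returns)) (∑-const n (n * returns))) ⟩
        2 * (n * (n * returns))
          ≤⟨ *-monoʳ-≤ 2 (*-monoʳ-≤ n (*-monoʳ-≤ n (begin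
               returns                               ≡⟨ ∑-swap₂ (λ c x y → B′ c * pr c x y) ⟨
               ∑ (λ c → ∑ (λ x → ∑ (λ y → B′ c * pr c x y))) ≡⟨ ∑-cong (λ c → ∑∑-*ˡ (B′ c) (pr c)) ⟩
               ∑ (λ c → B′ c * pairCount (gr c))  ≤⟨ ∑-mono few-returns ⟩
               ∑ (λ c → B′ c * (8 + β))              ≡⟨ ∑-*ʳ B′ (8 + β) ⟩
               count w (8 + β) * (8 + β)             ∎))) ⟩
        2 * (n * (n * (count w (8 + β) * (8 + β)))) ∎
        where
        open ≤-Reasoning
        returns = ∑ (λ x → ∑ (λ y → ∑ (λ c → B′ c * pr c x y)))

    module _ (W b : ℕ) (pos : 0 < n * n * b) (large : 4 * (n * n * b) ≤ m * (W * W)) where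

      -- At least m W²/2 switches lead out of each source and at most n² b lead into each target;
      -- `large` makes the first number twice the second.
      halve : ∀ {w β} → W ≤ w → 8 + β ≤ b → 2 * count (2 + w) β ≤ count w (8 + β)
      halve {w} {β} W≤w β≤b = *-cancelʳ-≤ _ _ (2 * (n * n * b)) (begin
        2 * C * (2 * (n * n * b))                  ≡⟨ arith₁ C (n * n * b) ⟩
        C * (4 * (n * n * b))                      ≤⟨ *-monoʳ-≤ C large ⟩
        C * (m * (W * W))                          ≤⟨ *-monoʳ-≤ C (*-monoʳ-≤ m (*-mono-≤ W≤w W≤w)) ⟩
        C * (m * (w * w))                          ≤⟨ double-count w β ⟩
        2 * (n * (n * (C′ * (8 + β))))             ≤⟨ *-monoʳ-≤ 2 (*-monoʳ-≤ n (*-monoʳ-≤ n (*-monoʳ-≤ C′ β≤b))) ⟩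
        2 * (n * (n * (C′ * b)))                   ≡⟨ arith₂ n C′ b ⟩
        C′ * (2 * (n * n * b))                     ∎)
        where
        open ≤-Reasoning
        C = count (2 + w) β
        C′ = count w (8 + β)
        instance
          nz : NonZero (2 * (n * n * b))
          nz = >-nonZero (≤-trans pos (m≤m+n (n * n * b) _))
        arith₁ : ∀ c k → 2 * c * (2 * k) ≡ c * (4 * k)
        arith₁ = solve-∀
        arith₂ : ∀ n c b → 2 * (n * (n * (c * b))) ≡ c * (2 * (n * n * b))
        arith₂ = solve-∀

      -- `W` and `b` bound the thresholds throughout all t rounds, so the single inequality `large`
      -- serves every one of them.
      halve-iterated : ∀ t {β} → t * 8 + β ≤ b → 2 ^ t * count (t * 2 + W) β ≤ count W (t * 8 + β)
      halve-iterated zero {β} h = ≤-reflexive (*-identityˡ (count W β))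
      halve-iterated (suc t) {β} h = begin
        2 * 2 ^ t * count (2 + (t * 2 + W)) β      ≡⟨ arith (2 ^ t) (count (2 + (t * 2 + W)) β) ⟩
        2 ^ t * (2 * count (2 + (t * 2 + W)) β)    ≤⟨ *-monoʳ-≤ (2 ^ t) (halve (m≤n+m W (t * 2)) (≤-trans (m≤n+m (8 + β) (t * 8)) h′)) ⟩
        2 ^ t * count (t * 2 + W) (8 + β)          ≤⟨ halve-iterated t h′ ⟩
        count W (t * 8 + (8 + β))                  ≡⟨ cong (count W) (shift (t * 8) β) ⟩
        count W (suc t * 8 + β)                    ∎
        where
        open ≤-Reasoning
        shift : ∀ k β → k + (8 + β) ≡ 8 + k + β
        shift = solve-∀
        h′ : t * 8 + (8 + β) ≤ b
        h′ = ≤-trans (≤-reflexive (shift (t * 8) β)) h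
        arith : ∀ a c → 2 * a * c ≡ a * (2 * c)
        arith = solve-∀

  faceSize≤2m : ∀ {g n} {G : RawGraph n} → IsSimple G → (E : Embedding g G) → ∀ j →
    faceSize E j ≤ 2 * edgeCount G
  faceSize≤2m {n = n} {G} simple E j = begin
    faceSize E j
      ≤⟨ ∑-mono (λ u → ∑-mono (λ v → ⟦⟧-mono (λ e → proj₁ (∧-true {G u v} e)))) ⟩
    ∑ (λ u → ∑ (λ v → ⟦ G u v ⟧))
      ≤⟨ handshake G (proj₁ simple) ⟩
    2 * edgeCount G + ∑ (λ u → ⟦ G u u ⟧)
      ≡⟨ cong (2 * edgeCount G +_) (trans (∑-cong (λ u → cong ⟦_⟧ (proj₂ simple u))) (trans (∑-const n 0) (*-zeroʳ n))) ⟩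
    2 * edgeCount G + 0
      ≡⟨ +-identityʳ _ ⟩
    2 * edgeCount G ∎
    where open ≤-Reasoning

  length-filter-∑ : ∀ {N} {P : Fin N → Set} (P? : ∀ i → Dec (P i)) →
    length (filter P? (allFin N)) ≡ ∑ (λ i → ⟦ isYes (P? i) ⟧)
  length-filter-∑ {N} P? = go (allFin N)
    where
    go : ∀ xs → length (filter P? xs) ≡ sum (map (λ i → ⟦ isYes (P? i) ⟧) xs)
    go [] = refl
    go (x ∷ xs) with P? x
    ... | yes _ = cong suc (go xs)
    ... | no _ = go xs

  floor : ∀ n d .{{_ : NonZero d}} → ∃[ w ] (w * d ≤ n × n < suc w * d)
  floor n d = n / d , subst (n / d * d ≤_) (sym eq) (m≤n+m _ (n % d)) ,
    subst (_< suc (n / d) * d) (sym eq) (+-monoˡ-< (n / d * d) (m%n<n n d))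
    where
    eq : n ≡ n % d + n / d * d
    eq = m≡m%n+[m/n]*n n d

  n<2^n : ∀ n → n < 2 ^ n
  n<2^n zero = s≤s z≤n
  n<2^n (suc n) = ≤-trans (s≤s (≤-trans (n<2^n n) (m≤m+n _ _))) (+-mono-≤ (≤-trans (s≤s z≤n) (n<2^n n)) (≤-reflexive refl))

  distinct-graphs : ∀ {n} {c d : Fin ((2 ^ n) ^ n)} → c ≢ d → ∃[ u ] ∃[ v ] graph {n} c u v ≢ graph {n} d u v
  distinct-graphs {n} {c} {d} c≢d
    with any? (λ u → any? (λ v → ¬? (graph {n} c u v Bool.≟ graph {n} d u v)))
  ... | yes w = w
  ... | no none = ⊥-elim (c≢d (trans (sym (code-graph {n} c)) (trans
    (code-cong {G = graph {n} c} {graph {n} d} (λ u v → decidable-stable (graph {n} c u v Bool.≟ graph {n} d u v)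
      (λ ne → none (u , v , ne)))) (code-graph {n} d))))

  module Bounds (q s n m t : ℕ) (1≤q : 1 ≤ q) (1≤t : 1 ≤ t)
                (s≥ : 8 * (8 * q * (8 * q * (8 * q))) ≤ s) (n≥₁ : 8 * q * t ≤ n) (n≥₂ : s * (8 * t) ≤ n)
                (n≤qm : n ≤ q * m) (gap : n + q * m ≤ q * n) where
    open ≤-Reasoning

    private instance
      4q≢0 : NonZero (4 * q)
      4q≢0 = >-nonZero (≤-trans 1≤q (m≤n*m q 4))

    -- If every face is smaller than n/s, where s ≥ 2q, then n - m ≥ n/q leaves more than n/(2q)
    -- isolated vertices. The starting threshold t * 2 + W must stay below this; as 2t ≤ W, the
    -- choice n/(4q), rounded down, works.
    W : ℕ
    W = proj₁ (floor n (4 * q))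

    2q≤s : 2 * q ≤ s
    2q≤s = begin
      2 * q                              ≤⟨ *-monoˡ-≤ q {2} {8} (s≤s (s≤s z≤n)) ⟩
      8 * q                              ≡⟨ *-identityʳ (8 * q) ⟨
      8 * q * 1                          ≤⟨ *-monoʳ-≤ (8 * q) (*-mono-≤ 1≤8q 1≤8q) ⟩
      8 * q * (8 * q * (8 * q))          ≤⟨ m≤n*m _ 8 ⟩
      8 * (8 * q * (8 * q * (8 * q)))    ≤⟨ s≥ ⟩
      s                                  ∎
      where
      1≤8q : 1 ≤ 8 * q
      1≤8q = ≤-trans 1≤q (m≤n*m q 8)

    W≤ : W * (4 * q) ≤ n
    W≤ = proj₁ (proj₂ (floor n (4 * q)))

    W> : n < suc W * (4 * q)
    W> = proj₂ (proj₂ (floor n (4 * q)))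

    below-W : ∀ {k} → k * (4 * q) ≤ n → k ≤ W
    below-W h = ≤-pred (*-cancelʳ-< _ _ _ (≤-<-trans h W>))

    2t≤W : t * 2 ≤ W
    2t≤W = below-W (≤-trans (≤-reflexive (arith t q)) n≥₁)
      where
      arith : ∀ t q → t * 2 * (4 * q) ≡ 8 * q * t
      arith = solve-∀

    1≤W : 1 ≤ W
    1≤W = ≤-trans (≤-trans (s≤s z≤n) (*-monoˡ-≤ 2 1≤t)) 2t≤W

    n≤8qW : n ≤ 8 * q * W
    n≤8qW = begin
      n                    ≤⟨ <⇒≤ W> ⟩
      suc W * (4 * q)      ≤⟨ *-monoˡ-≤ (4 * q) (+-monoˡ-≤ W 1≤W) ⟩
      (W + W) * (4 * q)    ≡⟨ arith W q ⟩
      8 * q * W            ∎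
      where
      arith : ∀ W q → (W + W) * (4 * q) ≡ 8 * q * W
      arith = solve-∀

    private instance
      s≢0 : NonZero s
      s≢0 = >-nonZero (≤-trans (≤-trans 1≤q (m≤n*m q 2)) 2q≤s)

    -- `β` is n/s rounded down, the bound on pairs when faces are smaller than n/s. After t rounds
    -- it has grown to `β⁺`, still at most 2n/s because 8t ≤ n/s.
    β β⁺ : ℕ
    β = proj₁ (floor n s)
    β⁺ = t * 8 + β

    few-pairs : ∀ {k} → s * k < n → k ≤ β
    few-pairs {k} h = ≤-pred (*-cancelʳ-< _ _ _
      (≤-<-trans (≤-trans (≤-reflexive (*-comm k s)) (<⇒≤ h)) (proj₂ (proj₂ (floor n s)))))

    s*β⁺≤2n : s * β⁺ ≤ 2 * n
    s*β⁺≤2n = begin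
      s * (t * 8 + β)           ≡⟨ arith s t β ⟩
      s * (8 * t) + β * s       ≤⟨ +-mono-≤ n≥₂ (proj₁ (proj₂ (floor n s))) ⟩
      n + n                     ≡⟨ cong (n +_) (+-identityʳ n) ⟨
      2 * n                     ∎
      where
      arith : ∀ s t β → s * (t * 8 + β) ≡ s * (8 * t) + β * s
      arith = solve-∀

    1≤n : 1 ≤ n
    1≤n = ≤-trans (*-mono-≤ (≤-trans 1≤q (m≤n*m q 8)) 1≤t) n≥₁

    positive : 0 < n * n * β⁺
    positive = *-mono-≤ (*-mono-≤ 1≤n 1≤n) (≤-trans (≤-trans 1≤t (m≤m*n t 8)) (m≤m+n (t * 8) β))

    -- The left side is at most 8n³/s, while m and `W` are both at least n/(8q). Weakening n ≤ q m
    -- to n ≤ 8q m makes the product a cube, the origin of s ≥ 8 (8q)³.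
    large : 4 * (n * n * β⁺) ≤ m * (W * W)
    large = *-cancelˡ-≤ s (begin
      s * (4 * (n * n * β⁺))                    ≡⟨ arith₁ s n β⁺ ⟩
      4 * (n * n * (s * β⁺))                    ≤⟨ *-monoʳ-≤ 4 (*-monoʳ-≤ (n * n) s*β⁺≤2n) ⟩
      4 * (n * n * (2 * n))                    ≡⟨ arith₂ n ⟩
      8 * (n * (n * n))                        ≤⟨ *-monoʳ-≤ 8 (*-mono-≤ (≤-trans n≤qm (*-monoˡ-≤ m (m≤n*m q 8))) (*-mono-≤ n≤8qW n≤8qW)) ⟩
      8 * (r * m * (r * W * (r * W)))          ≡⟨ arith₃ r m W ⟩
      8 * (r * (r * r)) * (m * (W * W))        ≤⟨ *-monoˡ-≤ (m * (W * W)) s≥ ⟩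
      s * (m * (W * W))                        ∎)
      where
      r = 8 * q
      arith₁ : ∀ s n b → s * (4 * (n * n * b)) ≡ 4 * (n * n * (s * b))
      arith₁ = solve-∀
      arith₂ : ∀ n → 4 * (n * n * (2 * n)) ≡ 8 * (n * (n * n))
      arith₂ = solve-∀
      arith₃ : ∀ r m W → 8 * (r * m * (r * W * (r * W))) ≡ 8 * (r * (r * r)) * (m * (W * W))
      arith₃ = solve-∀

    many-isolated : ∀ {i F} → n ≤ m + i + F → s * F < n → t * 2 + W < i
    many-isolated {i} {F} size small = *-cancelʳ-< (2 * q) _ _ (begin-strict
      (t * 2 + W) * (2 * q)        ≤⟨ *-monoˡ-≤ (2 * q) (+-monoˡ-≤ W 2t≤W) ⟩
      (W + W) * (2 * q)            ≡⟨ arith₁ W q ⟩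
      W * (4 * q)                  ≤⟨ W≤ ⟩
      n                            <⟨ +-cancelʳ-< n _ _ doubled ⟩
      i * (2 * q)                  ∎)
      where
      arith₁ : ∀ W q → (W + W) * (2 * q) ≡ W * (4 * q)
      arith₁ = solve-∀
      arith₂ : ∀ q m i F → q * (m + i + F) ≡ q * i + q * F + q * m
      arith₂ = solve-∀
      arith₃ : ∀ q i F → 2 * (q * i + q * F) ≡ i * (2 * q) + 2 * q * F
      arith₃ = solve-∀
      half : n ≤ q * i + q * F
      half = +-cancelʳ-≤ (q * m) _ _ (begin
        n + q * m                  ≤⟨ gap ⟩
        q * n                      ≤⟨ *-monoʳ-≤ q size ⟩
        q * (m + i + F)            ≡⟨ arith₂ q m i F ⟩
        q * i + q * F + q * m      ∎)
      doubled : n + n < i * (2 * q) + n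
      doubled = begin-strict
        n + n                      ≡⟨ cong (n +_) (+-identityʳ n) ⟨
        2 * n                      ≤⟨ *-monoʳ-≤ 2 half ⟩
        2 * (q * i + q * F)        ≡⟨ arith₃ q i F ⟩
        i * (2 * q) + 2 * q * F    ≤⟨ +-monoʳ-≤ (i * (2 * q)) (*-monoˡ-≤ F 2q≤s) ⟩
        i * (2 * q) + s * F        <⟨ +-monoʳ-< (i * (2 * q)) small ⟩
        i * (2 * q) + n            ∎

  SmallFacesRare : (g n m s t : ℕ) → Set
  SmallFacesRare g n m s t = Σ (List (RawGraph n)) λ K → Σ (List (RawGraph n)) λ L →
    Distinct K × All (InS g n m) K ×
    (∀ G → InS g n m G → ¬ (Σ (Embedding g G) λ E → ∃[ j ] n ≤ s * faceSize E j) → G ∈G L) ×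
    t * length L ≤ length K

  module _ (g q s n m t : ℕ) (1≤q : 1 ≤ q) (1≤t : 1 ≤ t)
           (s≥ : 8 * (8 * q * (8 * q * (8 * q))) ≤ s) (n≥₁ : 8 * q * t ≤ n) (n≥₂ : s * (8 * t) ≤ n)
           (n≤qm : n ≤ q * m) (gap : n + q * m ≤ q * n) where
    open Bounds q s n m t 1≤q 1≤t s≥ n≥₁ n≥₂ n≤qm gap
    open Counting g n m

    -- The comparison list is not all of the graph class but only the graphs reached after t rounds,
    -- which already outnumber the exceptional ones by a factor 2ᵗ > t.
    small-faces-rare : SmallFacesRare g n m s t
    small-faces-rare = graphs W β⁺ , graphs (t * 2 + W) β ,
      AllPairs.map⁺ (AllPairs.filter⁺ (λ c → bad? W β⁺ (gr c)) (AllPairs.map distinct-graphs (allFin⁺ Codes))) ,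
      All.map⁺ (All.map in-S (All.all-filter (λ c → bad? W β⁺ (gr c)) (allFin Codes))) ,
      covers , (begin
        t * length (graphs (t * 2 + W) β)    ≤⟨ *-monoˡ-≤ _ (<⇒≤ (n<2^n t)) ⟩
        2 ^ t * length (graphs (t * 2 + W) β) ≡⟨ cong (2 ^ t *_) (length-graphs (t * 2 + W) β) ⟩
        2 ^ t * count (t * 2 + W) β          ≤⟨ halve-iterated W β⁺ positive large t ≤-refl ⟩
        count W β⁺                            ≡⟨ length-graphs W β⁺ ⟨
        length (graphs W β⁺)                  ∎)
      where
      open ≤-Reasoning
      v₀ : Fin n
      v₀ = fromℕ< 1≤n
      graphs : ℕ → ℕ → List (RawGraph n)
      graphs w β = map gr (filter (λ c → bad? w β (gr c)) (allFin Codes))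
      length-graphs : ∀ w β → length (graphs w β) ≡ count w β
      length-graphs w β = trans (length-map gr (filter (λ c → bad? w β (gr c)) (allFin Codes))) (length-filter-∑ (λ c → bad? w β (gr c)))
      in-S : ∀ {c} → Bad W β⁺ (gr c) → InS g n m (gr c)
      in-S (simple , e , W₀ , _) = simple , e , proj₁ (weak⇒embedding simple v₀ W₀)
      covers : ∀ G → InS g n m G →
        ¬ (Σ (Embedding g G) λ E → ∃[ j ] n ≤ s * faceSize E j) → G ∈G graphs (t * 2 + W) β
      covers G (simple , e , E₀) none = Any.map⁺ (lose
        (∈-filter⁺ (λ c → bad? (t * 2 + W) β (gr c)) (∈-allFin (code G)) (bad-resp {t * 2 + W} {β} back bad))
        back)
        where
        W₀ : Weak g G
        W₀ = FromEmbedding.embedding⇒weak simple E₀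
        back : G ≗G gr (code G)
        back u v = sym (graph-code G u v)
        bad : Bad (t * 2 + W) β G
        bad = let (E , j , size , pairs) = weak⇒embedding simple v₀ W₀
                  small = ≰⇒> (λ h → none (E , j , h))
              in simple , e , W₀ ,
                 many-isolated (subst (λ m → n ≤ m + isolatedCount G + faceSize E j) e size) small ,
                 few-pairs (≤-<-trans (*-monoʳ-≤ s pairs) small)

  -- The order of quantifiers matters: `s`, and with it the constant c, depends on `q` alone, while
  -- the failure ratio 1/t affects only how large n must be.
  small-faces-rare-eventually : ∀ g q → 1 ≤ q → ∃[ s ] (∀ t → 1 ≤ t → ∃[ N ] (∀ n m → N ≤ n →
    n ≤ q * m → n + q * m ≤ q * n →
    SmallFacesRare g n m (suc s) t))
  small-faces-rare-eventually g q 1≤q =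
    let s = 8 * (8 * q * (8 * q * (8 * q))) in
    s , λ t 1≤t → 8 * q * t + suc s * (8 * t) , λ n m N≤n →
      small-faces-rare g q (suc s) n m t 1≤q 1≤t (n≤1+n s)
        (≤-trans (m≤m+n _ _) N≤n) (≤-trans (m≤n+m _ (8 * q * t)) N≤n)

-- Passage to rational constants and probabilities

open Combinatorics using (faceSize≤2m; SmallFacesRare; small-faces-rare-eventually)
open import Data.Nat using (suc; z≤n; s≤s)
import Data.Nat as ℕ
import Data.Nat.Properties as ℕ
open import Data.Nat.Coprimality using (1-coprimeTo)
open import Data.Nat.Tactic.RingSolver using (solve-∀)
open import Data.Integer using (+_; -[1+_]; +[1+_])
import Data.Integer as ℤ
import Data.Integer.Properties as ℤ
open import Data.Product using (_,_)
open import Data.Rational using (ℚ; 0ℚ; 1ℚ; _<_; _≤_; _*_)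
open import Data.Rational using (mkℚ; toℚᵘ; ↥_; ↧_; *≤*; *<*)
open import Data.Rational.Properties using (toℚᵘ-mono-≤; toℚᵘ-cancel-≤; toℚᵘ-homo-*; toℚᵘ-fromℚᵘ)
open import Data.Rational.Unnormalised using (mkℚᵘ; _≃_)
import Data.Rational.Unnormalised as ℚᵘ
import Data.Rational.Unnormalised.Properties as ℚᵘ
open import Data.List using (length)
open import Relation.Binary.PropositionalEquality using (_≡_; cong; subst; subst₂; sym)

toℚ-unnormalised : ∀ k → toℚᵘ (toℚ k) ≃ mkℚᵘ (+ k) 0
toℚ-unnormalised k = toℚᵘ-fromℚᵘ (mkℚᵘ (+ k) 0)

-- Without reduction to lowest terms the product keeps the denominator of `p`, so comparisons become
-- integer inequalities by cross-multiplication.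
multiple-unnormalised : ∀ p k → toℚᵘ (p * toℚ k) ≃ mkℚᵘ (↥ p ℤ.* + k) (ℚ.denominator-1 p)
multiple-unnormalised p@(mkℚ a d _) k = ℚᵘ.≃-trans (toℚᵘ-homo-* p (toℚ k))
  (ℚᵘ.≃-trans (ℚᵘ.*-congˡ {toℚᵘ p} (toℚ-unnormalised k))
    (ℚᵘ.*≡* (cong (λ e → a ℤ.* + k ℤ.* + e) (sym (ℕ.*-identityʳ (suc d))))))

multiple≤ : ∀ p k l → p * toℚ k ≤ toℚ l → ↥ p ℤ.* + k ℤ.≤ + l ℤ.* ↧ p
multiple≤ p k l h with ℚᵘ.≤-respˡ-≃ (multiple-unnormalised p k)
                        (ℚᵘ.≤-respʳ-≃ (toℚ-unnormalised l) (toℚᵘ-mono-≤ h))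
... | ℚᵘ.*≤* i = subst (ℤ._≤ + l ℤ.* ↧ p) (ℤ.*-identityʳ (↥ p ℤ.* + k)) i

≤multiple : ∀ p k l → toℚ k ≤ p * toℚ l → + k ℤ.* ↧ p ℤ.≤ ↥ p ℤ.* + l
≤multiple p k l h with ℚᵘ.≤-respˡ-≃ (toℚ-unnormalised k)
                        (ℚᵘ.≤-respʳ-≃ (multiple-unnormalised p l) (toℚᵘ-mono-≤ h))
... | ℚᵘ.*≤* i = subst (+ k ℤ.* ↧ p ℤ.≤_) (ℤ.*-identityʳ (↥ p ℤ.* + l)) i

multiple≤⁻ : ∀ p k l → ↥ p ℤ.* + k ℤ.≤ + l ℤ.* ↧ p → p * toℚ k ≤ toℚ l
multiple≤⁻ p k l i = toℚᵘ-cancel-≤ (ℚᵘ.≤-respˡ-≃ (ℚᵘ.≃-sym (multiple-unnormalised p k))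
  (ℚᵘ.≤-respʳ-≃ (ℚᵘ.≃-sym (toℚ-unnormalised l))
    (ℚᵘ.*≤* (subst (ℤ._≤ + l ℤ.* ↧ p) (sym (ℤ.*-identityʳ (↥ p ℤ.* + k))) i))))

≤multiple⁻ : ∀ p k l → + k ℤ.* ↧ p ℤ.≤ ↥ p ℤ.* + l → toℚ k ≤ p * toℚ l
≤multiple⁻ p k l i = toℚᵘ-cancel-≤ (ℚᵘ.≤-respˡ-≃ (ℚᵘ.≃-sym (toℚ-unnormalised k))
  (ℚᵘ.≤-respʳ-≃ (ℚᵘ.≃-sym (multiple-unnormalised p l))
    (ℚᵘ.*≤* (subst (+ k ℤ.* ↧ p ℤ.≤_) (sym (ℤ.*-identityʳ (↥ p ℤ.* + l))) i))))

-- Only the denominator d + 1 of a rational matters: a positive one is at least 1 / (d + 1), and one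
-- below 1 is at most d / (d + 1).

positive-upper : ∀ {a} → 0ℚ < a → ∃[ d ] (∀ k l → a * toℚ k ≤ toℚ l → k ℕ.≤ suc d ℕ.* l)
positive-upper {p@(mkℚ +[1+ a ] d _)} _ = d , λ k l h → ℕ.≤-trans (ℕ.m≤n*m k (suc a))
  (ℕ.≤-trans (ℤ.drop‿+≤+ (subst₂ ℤ._≤_ (sym (ℤ.pos-* (suc a) k)) (sym (ℤ.pos-* l (suc d))) (multiple≤ p k l h)))
    (ℕ.≤-reflexive (ℕ.*-comm l (suc d))))
positive-upper {mkℚ (+ 0) d _} (*<* (ℤ.+<+ ()))
positive-upper {mkℚ -[1+ a ] d _} (*<* ())

positive-lower : ∀ {a} → 0ℚ < a → ∃[ d ] (∀ k l → suc d ℕ.* k ℕ.≤ l → toℚ k ≤ a * toℚ l)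
positive-lower {p@(mkℚ +[1+ a ] d _)} _ = d , λ k l h → ≤multiple⁻ p k l
  (subst₂ ℤ._≤_ (ℤ.pos-* k (suc d)) (ℤ.pos-* (suc a) l)
    (ℤ.+≤+ (ℕ.≤-trans (ℕ.≤-reflexive (ℕ.*-comm k (suc d))) (ℕ.≤-trans h (ℕ.m≤n*m l (suc a))))))
positive-lower {mkℚ (+ 0) d _} (*<* (ℤ.+<+ ()))
positive-lower {mkℚ -[1+ a ] d _} (*<* ())

below-one : ∀ {b} → b < 1ℚ → ∃[ d ]
  (∀ k l → toℚ k ≤ b * toℚ l → l ℕ.+ suc d ℕ.* k ℕ.≤ suc d ℕ.* l)
below-one {p@(mkℚ a d _)} (*<* a<d) = d , λ k l h → ℕ.+-monoʳ-≤ l (begin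
  suc d ℕ.* k   ≡⟨ ℕ.*-comm (suc d) k ⟩
  k ℕ.* suc d   ≤⟨ ℤ.drop‿+≤+ (subst₂ ℤ._≤_ (sym (ℤ.pos-* k (suc d))) (sym (ℤ.pos-* d l))
                     (ℤ.≤-trans (≤multiple p k l h) (ℤ.*-monoʳ-≤-nonNeg (+ l) a≤d))) ⟩
  d ℕ.* l       ∎)
  where
  open ℕ.≤-Reasoning
  a≤d : a ℤ.≤ + d
  a≤d = ℤ.i<j⇒i≤pred[j] (subst₂ ℤ._<_ (ℤ.*-identityʳ a) (ℤ.*-identityˡ (+ suc d)) a<d)

module _ (g d₁ d₂ s : ℕ) where

  private
    q : ℕ
    q = suc d₁ ℕ.+ suc d₂

    c : ℚ
    c = mkℚ (+ 1) s (1-coprimeTo (suc s))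

  -- One `q` has to serve both the lower and the upper bound on m. The sum of the two denominators
  -- does, since k ≤ n lets the coefficient in the gap grow.
  combined-gap : ∀ n k → n ℕ.+ suc d₂ ℕ.* k ℕ.≤ suc d₂ ℕ.* n → k ℕ.≤ n → n ℕ.+ q ℕ.* k ℕ.≤ q ℕ.* n
  combined-gap n k gap k≤n = begin
    n ℕ.+ q ℕ.* k                                ≡⟨ arith n k (suc d₁) (suc d₂) ⟩
    suc d₁ ℕ.* k ℕ.+ (n ℕ.+ suc d₂ ℕ.* k)        ≤⟨ ℕ.+-mono-≤ (ℕ.*-monoʳ-≤ (suc d₁) k≤n) gap ⟩
    suc d₁ ℕ.* n ℕ.+ suc d₂ ℕ.* n                ≡⟨ ℕ.*-distribʳ-+ n (suc d₁) (suc d₂) ⟨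
    q ℕ.* n                                      ∎
    where
    open ℕ.≤-Reasoning
    arith : ∀ n k d e → n ℕ.+ (d ℕ.+ e) ℕ.* k ≡ d ℕ.* k ℕ.+ (n ℕ.+ e ℕ.* k)
    arith = solve-∀

  face-bounds : ∀ {n m} {G : RawGraph n} → InS g n m G → m ℕ.≤ n →
    (Σ (Embedding g G) λ E → ∃[ j ] n ℕ.≤ suc s ℕ.* faceSize E j) → FaceBounds g c (toℚ 2) G
  face-bounds {n} (simple , edges , _) m≤n (E , j , big) =
    (E , j , multiple≤⁻ c n (faceSize E j) (subst₂ ℤ._≤_ (sym (ℤ.*-identityˡ (+ n))) (ℤ.pos-* (faceSize E j) (suc s))
      (ℤ.+≤+ (ℕ.≤-trans big (ℕ.≤-reflexive (ℕ.*-comm (suc s) (faceSize E j))))))) ,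
    λ E′ j′ → ≤multiple⁻ (toℚ 2) (faceSize E′ j′) n (subst₂ ℤ._≤_ (sym (ℤ.*-identityʳ (+ faceSize E′ j′))) (ℤ.pos-* 2 n)
      (ℤ.+≤+ (ℕ.≤-trans (faceSize≤2m simple E′ j′)
        (ℕ.*-monoʳ-≤ 2 (subst (ℕ._≤ n) (sym edges) m≤n)))))

  fail-probability : ∀ {n m t ε} → m ℕ.≤ n → (∀ k l → t ℕ.* k ℕ.≤ l → toℚ k ≤ ε * toℚ l) →
    SmallFacesRare g n m (suc s) t → FailProbAtMost g n m (FaceBounds g c (toℚ 2)) ε
  fail-probability m≤n ratio (K , L , distinct , inS , covers , few) =
    K , L , distinct , inS ,
    (λ G G∈S bad → covers G G∈S (λ h → bad (face-bounds G∈S m≤n h))) ,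
    ratio (length L) (length K) few

theorem6p1 : (g : ℕ) (m : ℕ → ℕ) →
    (∃[ a ] (0ℚ < a × ∃[ N ] (∀ n → n ≥ N → a * toℚ n ≤ toℚ (m n)))) →
    (∃[ b ] (b < 1ℚ × ∃[ N ] (∀ n → n ≥ N → toℚ (m n) ≤ b * toℚ n))) →
    ∃[ c ] ∃[ C ] (0ℚ < c × c ≤ C ×
    (∀ ε → 0ℚ < ε → ∃[ N ] (∀ n → n ≥ N →
    FailProbAtMost g n (m n) (FaceBounds g c C) ε)))
theorem6p1 g m (a , 0<a , N₁ , lower) (b , b<1 , N₂ , upper) =
  let (d₁ , ratio₁) = positive-upper 0<a
      (d₂ , ratio₂) = below-one b<1
      (s , rare) = small-faces-rare-eventually g (suc d₁ ℕ.+ suc d₂) (s≤s z≤n)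
  in mkℚ (+ 1) s (1-coprimeTo (suc s)) , toℚ 2 , *<* (ℤ.+<+ (s≤s z≤n)) , *≤* (ℤ.+≤+ (s≤s z≤n)) ,
     λ ε 0<ε →
       let (t , ratio) = positive-lower 0<ε
           (N₃ , eventually) = rare (suc t) (s≤s z≤n)
       in N₁ ℕ.+ N₂ ℕ.+ N₃ , λ n n≥N →
         let n≥₁ = ℕ.≤-trans (ℕ.m≤m+n N₁ N₂) (ℕ.≤-trans (ℕ.m≤m+n _ N₃) n≥N)
             n≥₂ = ℕ.≤-trans (ℕ.m≤n+m N₂ N₁) (ℕ.≤-trans (ℕ.m≤m+n _ N₃) n≥N)
             gap = ratio₂ (m n) n (upper n n≥₂)
             -- Dropping the summand n from the gap leaves (d₂ + 1) m ≤ (d₂ + 1) n.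
             m≤n = ℕ.*-cancelˡ-≤ (suc d₂) (ℕ.≤-trans (ℕ.m≤n+m _ n) gap)
         in fail-probability g d₁ d₂ s {n} {m n} {suc t} {ε} m≤n ratio
           (eventually n (m n)
             (ℕ.≤-trans (ℕ.m≤n+m N₃ (N₁ ℕ.+ N₂)) n≥N)
             (ℕ.≤-trans (ratio₁ n (m n) (lower n n≥₁)) (ℕ.*-monoˡ-≤ (m n) (ℕ.m≤m+n (suc d₁) (suc d₂))))
             (combined-gap g d₁ d₂ s n (m n) gap m≤n))
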